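{- Let $G$ be a directed acyclic graph with $n$ vertices, $m$ arcs, and $T\ge 2$ topological orders, and suppose an unknown total order of the vertices is one of the topological orders of $G$. If topological heapsort is implemented with a heap that has the working-set bound provided that the heap ends empty, then topological heapsort run on $G$ takes $O(m+\log T)$ time and does $O(n+\log T)$ comparisons.
   Context: $\log$ is the base-two logarithm. A topological order of a directed acyclic graph is a total order of its vertices such that $v<w$ for every arc $vw$. A source is a vertex with no entering arcs. Vertices may be compared with respect to the unknown total order by binary comparisons, each taking unit time. Topological heapsort: initialize an empty list $L$; compute the in-degree of each vertex; initialize a heap $H$ by inserting all sources of $G$ (the key of a vertex is the vertex itself, ordered by the unknown total order). While $G$ is non-empty: delete the minimum vertex $v$ from $H$; add $v$ to the back of $L$; for each arc $vw$, decrement the in-degree of $w$, and if $w$ now has in-degree zero insert $w$ into $H$; then delete $v$ and its outgoing arcs from $G$. The input graph may be given as a list of its arcs. A heap is a data structure, initially empty, storing items with totally ordered keys and supporting find-min, insert and delete-min. Each item is regarded as inserted and deleted at most once. For an item $x$ that is inserted and later deleted, its working set is the set of items $y$ inserted at or after the time $x$ is inserted and before $x$ is deleted (so $x$ belongs to it), and $w(x)$ is the size of this set. The heap has the working-set bound if each find-min takes $O(1)$ time and no comparisons, each insertion takes $O(1)$ time, and each delete-min deleting an item $x$ takes $O(1+\log w(x))$ time, where these bounds may be amortized over the whole sequence of operations (the total time is at most the sum of the individual bounds). "Provided that it ends empty" means that these bounds are only required for operation sequences after which the heap is empty. The constants hidden in the conclusion depend only on the constants in the heap's bounds. -}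

module Defs where

open import Level using (0ℓ) renaming (suc to lsuc)
open import Data.Bool using (Bool; if_then_else_)
open import Data.Fin using (Fin)
open import Data.List using (List; []; _∷_; _∷ʳ_; length; map; allFin)
open import Data.List.Membership.Propositional using (_∈_)
open import Data.List.Relation.Binary.Permutation.Propositional using (_↭_)
open import Data.List.Relation.Unary.All using (All)
open import Data.List.Relation.Unary.Unique.Propositional using (Unique)
open import Data.Maybe using (Maybe; just; nothing)
open import Data.Nat using (ℕ; zero; suc; pred; _+_; _*_; _≤_)
open import Data.Nat.ListAction using (sum)
open import Data.Nat.Logarithm using (⌈log₂_⌉)
open import Data.Product using (_×_; _,_; proj₁; proj₂; swap)
open import Data.Unit using (⊤; tt)
open import Data.Vec using (Vec; replicate; lookup; _[_]≔_)
open import Function using (_∘_; id)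
open import Function.Bundles using (Inverse)
open import Relation.Binary using (Rel; Setoid; IsStrictTotalOrder)
open import Relation.Binary.Core using (_⇔_)
open import Relation.Binary.Construct.Closure.Transitive using (TransClosure)
open import Relation.Binary.Definitions using (DecidableEquality)
open import Relation.Binary.PropositionalEquality using (_≡_; setoid)
open import Relation.Nullary using (¬_; does)

record DAG (n : ℕ) : Set where
  field
    arcs     : List (Fin n × Fin n)
    distinct : Unique arcs

  Arc : Rel (Fin n) 0ℓ
  Arc v w = (v , w) ∈ arcs

  field
    acyclic : ∀ v → ¬ TransClosure Arc v v

  #arcs : ℕ
  #arcs = length arcs

record TopologicalOrder {n : ℕ} (G : DAG n) : Set₁ where
  open DAG G using (Arc)
  infix 4 _<_
  field
    _<_                : Rel (Fin n) 0ℓ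
    isStrictTotalOrder : IsStrictTotalOrder _≡_ _<_
    respectsArcs       : ∀ {v w} → Arc v w → v < w

-- Two topological orders are the same when they relate the same pairs.
topologicalOrders : ∀ {n} → DAG n → Setoid (lsuc 0ℓ) 0ℓ
topologicalOrders G = record
  { Carrier       = TopologicalOrder G
  ; _≈_           = λ O P → TopologicalOrder._<_ O ⇔ TopologicalOrder._<_ P
  ; isEquivalence = record
    { refl  = id , id
    ; sym   = swap
    ; trans = λ (f , f⁻¹) (g , g⁻¹) → (λ p → g (f p)) , (λ q → f⁻¹ (g⁻¹ q))
    }
  }

_hasTopologicalOrders_ : ∀ {n} → DAG n → ℕ → Set₁
G hasTopologicalOrders T = Inverse (setoid (Fin T)) (topologicalOrders G)

-- Computations that access the order on K only through binary
-- comparisons.  A comparison takes unit time; `step` is any other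
-- unit-time operation.
data Comp (K A : Set) : Set where
  return  : A → Comp K A
  step    : Comp K A → Comp K A
  compare : K → K → (Bool → Comp K A) → Comp K A

infixl 1 _>>=_ _>>_

_>>=_ : ∀ {K A B} → Comp K A → (A → Comp K B) → Comp K B
return a      >>= f = f a
step c        >>= f = step (c >>= f)
compare x y c >>= f = compare x y (λ b → c b >>= f)

_>>_ : ∀ {K A B} → Comp K A → Comp K B → Comp K B
c >> d = c >>= λ _ → d

tick : ∀ {K} → Comp K ⊤
tick = step (return tt)

record Outcome (A : Set) : Set where
  constructor outcome
  field
    value       : A
    time        : ℕ
    comparisons : ℕ

open Outcome public

-- `less x y` is the answer to the comparison "x < y?".
run : ∀ {K A} → (less : K → K → Bool) → Comp K A → Outcome A
run less (return a) = outcome a 0 0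
run less (step c) = let o = run less c in
  outcome (value o) (suc (time o)) (comparisons o)
run less (compare x y c) = let o = run less (c (less x y)) in
  outcome (value o) (suc (time o)) (suc (comparisons o))

lessThan : {K : Set} {_<_ : Rel K 0ℓ} → IsStrictTotalOrder _≡_ _<_ → K → K → Bool
lessThan sto x y = does (IsStrictTotalOrder._<?_ sto x y)

-- Every item is its own key.
record RawHeap : Set₁ where
  field
    State     : Set → Set
    empty     : ∀ {K} → State K
    findMin   : ∀ {K} → State K → Comp K (Maybe K × State K)
    insert    : ∀ {K} → K → State K → Comp K (State K)
    deleteMin : ∀ {K} → State K → Comp K (Maybe K × State K)

-- A heap operation together with the item it inserts or must return.
data Event (K : Set) : Set where
  found inserted deleted : K → Event K

answer : ∀ {K} → Event K → Maybe K
answer (found x)    = just x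
answer (inserted _) = nothing
answer (deleted x)  = just x

insertions : ∀ {K} → List (Event K) → List K
insertions []                = []
insertions (inserted x ∷ es) = x ∷ insertions es
insertions (found _ ∷ es)    = insertions es
insertions (deleted _ ∷ es)  = insertions es

-- `Transitions _<_ p es q`: with contents p, the events es are those of
-- a correct heap and lead to contents q.
data Transitions {K : Set} (_<_ : Rel K 0ℓ) : List K → List (Event K) → List K → Set where
  []        : ∀ {p} → Transitions _<_ p [] p
  inserting : ∀ {p x es q} → Transitions _<_ (x ∷ p) es q → Transitions _<_ p (inserted x ∷ es) q
  finding   : ∀ {p x r es q} → p ↭ x ∷ r → All (x <_) r → Transitions _<_ p es q → Transitions _<_ p (found x ∷ es) q
  deleting  : ∀ {p x r es q} → p ↭ x ∷ r → All (x <_) r → Transitions _<_ r es q → Transitions _<_ p (deleted x ∷ es) q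

record History {K : Set} (_<_ : Rel K 0ℓ) (es : List (Event K)) (contents : List K) : Set where
  field
    transitions  : Transitions _<_ [] es contents
    insertedOnce : Unique (insertions es)

module _ (R : RawHeap) where
  open RawHeap R

  -- The heap is not shown the expected answers in found and deleted.
  operate : ∀ {K} → Event K → State K → Comp K (Maybe K × State K)
  operate (found _)    s = findMin s
  operate (inserted x) s = insert x s >>= λ s′ → return (nothing , s′)
  operate (deleted _)  s = deleteMin s

  executeFrom : ∀ {K} → (K → K → Bool) → State K → List (Event K) → List (Event K × Outcome (Maybe K × State K))
  executeFrom less s []       = []
  executeFrom less s (e ∷ es) = let o = run less (operate e s) in
    (e , o) ∷ executeFrom less (proj₂ (value o)) es

  execute : ∀ {K} → (K → K → Bool) → List (Event K) → List (Event K × Outcome (Maybe K × State K))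
  execute less = executeFrom less empty

record Heap : Set₁ where
  field
    raw : RawHeap
  open RawHeap raw public
  field
    correct : ∀ {K} {_<_ : Rel K 0ℓ} (sto : IsStrictTotalOrder _≡_ _<_) {es contents} →
      History _<_ es contents →
      All (λ (e , o) → proj₁ (value o) ≡ answer e) (execute raw (lessThan sto) es)

-- The working set of x when x is about to be deleted, given all items
-- inserted so far, most recent first.
workingSet : {K : Set} → DecidableEquality K → K → List K → List K
workingSet _≟_ x []       = []
workingSet _≟_ x (y ∷ ys) = y ∷ (if does (x ≟ y) then [] else workingSet _≟_ x ys)

module _ (cf ci cd : ℕ) {K : Set} (_≟_ : DecidableEquality K) where

  timeBoundsFrom : List K → List (Event K) → List ℕ
  timeBoundsFrom past []                = []
  timeBoundsFrom past (found _ ∷ es)    = cf ∷ timeBoundsFrom past es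
  timeBoundsFrom past (inserted x ∷ es) = ci ∷ timeBoundsFrom (x ∷ past) es
  timeBoundsFrom past (deleted x ∷ es)  =
    cd * (1 + ⌈log₂ length (workingSet _≟_ x past) ⌉) ∷ timeBoundsFrom past es

  timeBounds : List (Event K) → List ℕ
  timeBounds = timeBoundsFrom []

-- The time bounds are amortized.  Only histories that leave the heap
-- empty are constrained.
record WorkingSetBoundIfEndsEmpty (H : Heap) (cf ci cd : ℕ) : Set₁ where
  open Heap H using (raw)
  field
    totalTime : ∀ {K} {_<_ : Rel K 0ℓ} (sto : IsStrictTotalOrder _≡_ _<_) {es} →
      History _<_ es [] →
      sum (map (time ∘ proj₂) (execute raw (lessThan sto) es))
        ≤ sum (timeBounds cf ci cd (IsStrictTotalOrder._≟_ sto) es)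
    findMinComparisons : ∀ {K} {_<_ : Rel K 0ℓ} (sto : IsStrictTotalOrder _≡_ _<_) {es} →
      History _<_ es [] →
      All (λ (e , o) → ∀ x → e ≡ found x → comparisons o ≡ 0) (execute raw (lessThan sto) es)

-- Unit-cost arrays.  They are only used single-threadedly below, so a
-- write can be done in place.
newArray : ∀ {K A} n → A → Comp K (Vec A n)
newArray n a = charge n >> return (replicate n a)
  where
  charge : ∀ {K} → ℕ → Comp K ⊤
  charge zero    = return tt
  charge (suc k) = step (charge k)

read : ∀ {K A n} → Vec A n → Fin n → Comp K A
read a i = step (return (lookup a i))

write : ∀ {K A n} → Vec A n → Fin n → A → Comp K (Vec A n)
write a i x = step (return (a [ i ]≔ x))

module TopologicalHeapsort (H : Heap) {n : ℕ} where
  open Heap H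

  private
    V = Fin n

  scanArcs : List (V × V) → Vec ℕ n → Vec (List V) n → Comp V (Vec ℕ n × Vec (List V) n)
  scanArcs []             deg out = tick >> return (deg , out)
  scanArcs ((v , w) ∷ as) deg out = do
    tick
    d    ← read deg w
    deg′ ← write deg w (suc d)
    ws   ← read out v
    out′ ← write out v (w ∷ ws)
    scanArcs as deg′ out′

  insertIfSource : ℕ → V → State V → Comp V (State V)
  insertIfSource zero    v h = tick >> insert v h
  insertIfSource (suc _) v h = tick >> return h

  insertSources : List V → Vec ℕ n → State V → Comp V (State V)
  insertSources []       deg h = tick >> return h
  insertSources (v ∷ vs) deg h = do
    tick
    d  ← read deg v
    h′ ← insertIfSource d v h
    insertSources vs deg h′

  processArcs : List V → Vec ℕ n → State V → Comp V (Vec ℕ n × State V)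
  processArcs []       deg h = tick >> return (deg , h)
  processArcs (w ∷ ws) deg h = do
    tick
    d    ← read deg w
    deg′ ← write deg w (pred d)
    h′   ← insertIfSource (pred d) w h
    processArcs ws deg′ h′

  -- The first argument is the number of vertices left in the graph, the
  -- last one the list L.  Adding to the back of L takes one step.
  mutual
    mainLoop : ℕ → Vec ℕ n → Vec (List V) n → State V → List V → Comp V (List V)
    mainLoop zero    deg out h L = tick >> return L
    mainLoop (suc k) deg out h L = do
      tick
      (v? , h′) ← deleteMin h
      processMin v? k deg out h′ L

    -- The case nothing does not arise: a non-empty acyclic graph has a
    -- source, and all remaining sources are in the heap.
    processMin : Maybe V → ℕ → Vec ℕ n → Vec (List V) n → State V → List V → Comp V (List V)
    processMin nothing  k deg out h L = return L
    processMin (just v) k deg out h L = do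
      tick
      let L′ = L ∷ʳ v
      ws          ← read out v
      (deg′ , h′) ← processArcs ws deg h
      out′        ← write out v []
      mainLoop k deg′ out′ h′ L′

  topologicalHeapsort : List (V × V) → Comp V (List V)
  topologicalHeapsort as = do
    tick
    deg₀        ← newArray n 0
    out₀        ← newArray n []
    (deg , out) ← scanArcs as deg₀ out₀
    h           ← insertSources (allFin n) deg empty
    mainLoop n deg out h []

runTopologicalHeapsort : (H : Heap) → ∀ {n} (G : DAG n) → TopologicalOrder G → Outcome (List (Fin n))
runTopologicalHeapsort H G O =
  run (lessThan (TopologicalOrder.isStrictTotalOrder O))
      (TopologicalHeapsort.topologicalHeapsort H (DAG.arcs G))

{-# OPTIONS --safe #-}

-- Measure time by the number of insertions.  The working set of v is then the interval of time
-- that v spends in the heap, and for an arc vw the interval of v ends before that of w begins.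
-- Hence any choice of a point in each interval induces a topological order, and since only 4^n
-- weakly increasing sequences in [0 , n) of length n can induce the same order, the product of
-- the working set sizes is at most 4^n T.  Thus the heap operations take O(n + log T) time.
-- Moreover n ≤ 2 m + log T + 1, because the vertices that lie on no arc can be put
-- independently before or after a fixed vertex.
module Submission where

open import Defs
open import Level using (0ℓ)
open import Data.Bool using (Bool; if_then_else_)
open import Data.Fin using (Fin; zero; suc; toℕ; fromℕ<; combine; remQuot; funToFin; finToFun)
open import Data.Fin.Properties using (combine-remQuot; combine-injective; finToFun-funToFin; injective⇒≤; toℕ-injective; toℕ-fromℕ<; toℕ<n; any?)
import Data.Fin.Properties as Fin
open import Data.List using (List; []; _∷_; _++_; _∷ʳ_; length; map; tabulate; allFin; filter; concatMap)
open import Data.List.Properties using (length-++; length-map; length-tabulate; map-tabulate; map-++; filter-accept; filter-reject; filter-some; filter-none)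
open import Data.List.Membership.DecPropositional using () renaming (_∈?_ to member?)
open import Data.List.Membership.Propositional using (_∈_; _∉_; find; lose)
open import Data.List.Membership.Propositional.Properties using (∈-++⁺ˡ; ∈-++⁺ʳ; ∈-++⁻; ∈-map⁺; ∈-allFin; ∈-∃++; ∈-concatMap⁺; ∈-concatMap⁻)
open import Data.List.Relation.Binary.Permutation.Propositional using (_↭_; ↭-refl; ↭-sym; ↭-trans; prep; ↭⇒↭ₛ)
open import Data.List.Relation.Binary.Permutation.Propositional.Properties using (∈-resp-↭; ↭-length; shift; ++⁺ˡ; ++⁺ʳ; filter-↭)
import Data.List.Relation.Binary.Permutation.Propositional.Properties as ↭
import Data.List.Relation.Binary.Permutation.Setoid.Properties as ↭ₛ
open import Data.List.Relation.Unary.All using (All; []; _∷_)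
import Data.List.Relation.Unary.All as All
import Data.List.Relation.Unary.All.Properties as All
open import Data.List.Relation.Unary.AllPairs using (AllPairs; []; _∷_)
open import Data.List.Relation.Unary.Any using (here; there)
open import Data.List.Relation.Unary.Sorted.TotalOrder.Properties using (Sorted⇒AllPairs)
open import Data.List.Relation.Unary.Unique.Propositional using (Unique)
open import Data.List.Relation.Unary.Unique.Propositional.Properties using (allFin⁺; Unique[x∷xs]⇒x∉xs)
open import Data.List.Sort using () renaming (sort to sortBy; sort-↭ to sortBy-↭; sort-↗ to sortBy-↗)
open import Data.Maybe using (Maybe; just; nothing)
open import Data.Nat using (ℕ; zero; suc; pred; _+_; _*_; _^_; _≤_; _<_; z≤n; s≤s; NonZero; >-nonZero)
open import Data.Nat.Induction using (<-wellFounded; Acc; acc)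
open import Data.Nat.ListAction using (sum; product)
open import Data.Nat.ListAction.Properties using (sum-++; sum-↭)
open import Data.Nat.Logarithm
open import Data.Nat.Properties
open import Data.Nat.Tactic.RingSolver using (solve-∀)
open import Data.Product using (_×_; _,_; proj₁; proj₂; ∃-syntax)
open import Data.Sum using (_⊎_; inj₁; inj₂; [_,_]′)
open import Data.Vec using (Vec; replicate; lookup; _[_]≔_)
open import Data.Vec.Properties using (lookup∘update; lookup∘update′; lookup-replicate)
open import Function using (_∘_; id)
open import Function.Bundles using (Inverse)
open import Relation.Binary using (Rel; Setoid; IsStrictTotalOrder; StrictTotalOrder; DecTotalOrder; Transitive; Trichotomous; tri<; tri≈; tri>)
open import Relation.Binary.PropositionalEquality
import Relation.Binary.Properties.StrictTotalOrder as STO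
open import Relation.Nullary using (¬_; Dec; yes; no; does; contradiction)

-- Finite sums

-- The heap bounds are amortized and constrain only whole histories that end empty, so no single
-- operation can be charged. The run is therefore first shown to produce a correct history, with the
-- heap costs kept apart from all other steps, and the bound is applied once, to the complete
-- history. One counting lemma serves both the intervals and the isolated vertices: a choice is
-- recovered from the order it induces together with a code, where the code takes `2 ^ (n + n)`
-- values in the first case and a single value in the second. To count in exact powers of two, an
-- interval of size `k` is cut down to `2 ^ pred ⌈log₂ k ⌉` points, which loses at most one bit per
-- vertex. With the `2 * n` bits of the code this makes the `3 * n` of `intervals-bound`. Nothing
-- outside the heap compares vertices, and the heap time is bounded in terms of `n` and `log T`; the
-- number of arcs enters the time bound only.

sum-mono-≤ : ∀ {n} {f g : Fin n → ℕ} → (∀ i → f i ≤ g i) → sum (tabulate f) ≤ sum (tabulate g)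
sum-mono-≤ {zero}  f≤g = z≤n
sum-mono-≤ {suc n} f≤g = +-mono-≤ (f≤g zero) (sum-mono-≤ (f≤g ∘ suc))

sum-mono-< : ∀ {n} {f g : Fin n → ℕ} → (∀ i → f i ≤ g i) → ∀ j → f j < g j → sum (tabulate f) < sum (tabulate g)
sum-mono-< f≤g zero    fj<gj = +-mono-<-≤ fj<gj (sum-mono-≤ (f≤g ∘ suc))
sum-mono-< f≤g (suc j) fj<gj = +-mono-≤-< (f≤g zero) (sum-mono-< (f≤g ∘ suc) j fj<gj)

sum-const-1 : ∀ n → sum (tabulate {n = n} (λ _ → 1)) ≡ n
sum-const-1 zero    = refl
sum-const-1 (suc n) = cong suc (sum-const-1 n)

sum-zero : ∀ n → sum (tabulate {n = n} (λ _ → 0)) ≡ 0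
sum-zero zero    = refl
sum-zero (suc n) = sum-zero n

sum-distrib-+ : ∀ {n} (f g : Fin n → ℕ) →
  sum (tabulate (λ i → f i + g i)) ≡ sum (tabulate f) + sum (tabulate g)
sum-distrib-+ {zero}  f g = refl
sum-distrib-+ {suc n} f g =
  trans (cong (f zero + g zero +_) (sum-distrib-+ (f ∘ suc) (g ∘ suc)))
        (interchange (f zero) (g zero) (sum (tabulate (f ∘ suc))) _)
  where
  interchange : ∀ a b c d → (a + b) + (c + d) ≡ (a + c) + (b + d)
  interchange = solve-∀

sum-distrib-* : ∀ {n} c (f : Fin n → ℕ) → sum (tabulate (λ i → c * f i)) ≡ c * sum (tabulate f)
sum-distrib-* {zero}  c f = sym (*-zeroʳ c)
sum-distrib-* {suc n} c f =
  trans (cong (c * f zero +_) (sum-distrib-* c (f ∘ suc))) (sym (*-distribˡ-+ c (f zero) _))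

product-2^ : ∀ {n} (l : Fin n → ℕ) → product (tabulate (λ i → 2 ^ l i)) ≡ 2 ^ sum (tabulate l)
product-2^ {zero}  l = refl
product-2^ {suc n} l =
  trans (cong (2 ^ l zero *_) (product-2^ (l ∘ suc))) (sym (^-distribˡ-+-* 2 (l zero) _))

indicator : {P : Set} → Dec P → ℕ
indicator p = if does p then 1 else 0

indicator-≤1 : {P : Set} (p : Dec P) → indicator p ≤ 1
indicator-≤1 (yes _) = s≤s z≤n
indicator-≤1 (no _)  = z≤n

indicator-mono : {P Q : Set} (p : Dec P) (q : Dec Q) → (P → Q) → indicator p ≤ indicator q
indicator-mono (yes p) (yes _) _   = ≤-refl
indicator-mono (yes p) (no ¬q) P→Q = contradiction (P→Q p) ¬q
indicator-mono (no _)  _       _   = z≤n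

indicator-< : {P Q : Set} (p : Dec P) (q : Dec Q) → ¬ P → Q → indicator p < indicator q
indicator-< (yes p) _       ¬p _ = contradiction p ¬p
indicator-< (no _)  (yes _) _  _ = s≤s z≤n
indicator-< (no _)  (no ¬q) _  q = contradiction q ¬q

-- Logarithms

-- Otherwise taking `⌈log₂_⌉` of `n < 2 ^ pred k`, for `k = ⌈log₂ n ⌉`, gives `k ≤ pred k`. Only
-- `k = 0` allows this, and there `n < 1`.
2^pred⌈log₂⌉≤ : ∀ n → 1 ≤ n → 2 ^ pred ⌈log₂ n ⌉ ≤ n
2^pred⌈log₂⌉≤ n 1≤n = ≮⇒≥ λ n<2^k → impossible ⌈log₂ n ⌉ n<2^k
  (subst (⌈log₂ n ⌉ ≤_) (⌈log₂2^n⌉≡n (pred ⌈log₂ n ⌉)) (⌈log₂⌉-mono-≤ (<⇒≤ n<2^k)))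
  where
  impossible : ∀ k → n < 2 ^ pred k → ¬ (k ≤ pred k)
  impossible zero    n<1 _   = <⇒≱ n<1 1≤n
  impossible (suc k) _   k<k = 1+n≰n k<k

⌊log₂[n*2^k]⌋ : ∀ n .{{_ : NonZero n}} k → ⌊log₂ (n * 2 ^ k) ⌋ ≡ ⌊log₂ n ⌋ + k
⌊log₂[n*2^k]⌋ n zero    = trans (cong ⌊log₂_⌋ (*-identityʳ n)) (sym (+-identityʳ _))
⌊log₂[n*2^k]⌋ n (suc k) = begin
  ⌊log₂ (n * (2 * 2 ^ k)) ⌋ ≡⟨ cong ⌊log₂_⌋ (swapFactors n (2 ^ k)) ⟩
  ⌊log₂ (2 * (n * 2 ^ k)) ⌋ ≡⟨ ⌊log₂[2*b]⌋≡1+⌊log₂b⌋ (n * 2 ^ k) ⟩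
  1 + ⌊log₂ (n * 2 ^ k) ⌋   ≡⟨ cong suc (⌊log₂[n*2^k]⌋ n k) ⟩
  suc (⌊log₂ n ⌋ + k)       ≡⟨ +-suc _ k ⟨
  ⌊log₂ n ⌋ + suc k         ∎
  where
  open ≡-Reasoning
  instance
    2^k≢0 : NonZero (2 ^ k)
    2^k≢0 = m^n≢0 2 k
    n*2^k≢0 : NonZero (n * 2 ^ k)
    n*2^k≢0 = m*n≢0 n (2 ^ k)
  swapFactors : ∀ a b → a * (2 * b) ≡ 2 * (a * b)
  swapFactors = solve-∀

2^≤*2^⇒≤log₂+ : ∀ {s k} n .{{_ : NonZero n}} → 2 ^ s ≤ n * 2 ^ k → s ≤ ⌊log₂ n ⌋ + k
2^≤*2^⇒≤log₂+ {s} {k} n 2^s≤ =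
  subst₂ _≤_ (⌊log₂[2^n]⌋≡n s) (⌊log₂[n*2^k]⌋ n k) (⌊log₂⌋-mono-≤ 2^s≤)

-- Families of choices

-- Mixed-radix digits, with radix `s i` at place `i`: they number all families of choices. Agreement
-- is tested pointwise below, so no function extensionality is required.
digits : ∀ {n} (s : Fin n → ℕ) → Fin (product (tabulate s)) → ∀ i → Fin (s i)
digits s k zero    = proj₁ (remQuot (product (tabulate (s ∘ suc))) k)
digits s k (suc i) = digits (s ∘ suc) (proj₂ (remQuot {s zero} (product (tabulate (s ∘ suc))) k)) i

digits-injective : ∀ {n} (s : Fin n → ℕ) {j k} → (∀ i → digits s j i ≡ digits s k i) → j ≡ k
digits-injective {zero}  s {zero} {zero} _  = refl
digits-injective {suc n} s {j}    {k}    eq = begin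
  j                                          ≡⟨ combine-remQuot {s zero} _ j ⟨
  combine (proj₁ (split j)) (proj₂ (split j)) ≡⟨ cong₂ combine (eq zero) (digits-injective (s ∘ suc) (eq ∘ suc)) ⟩
  combine (proj₁ (split k)) (proj₂ (split k)) ≡⟨ combine-remQuot {s zero} _ k ⟩
  k                                          ∎
  where
  open ≡-Reasoning
  split = remQuot {s zero} (product (tabulate (s ∘ suc)))

occupied : ∀ {n m} → (Fin n → ℕ) → Fin m → Fin 2
occupied g i = if does (any? λ v → g v ≟ toℕ i) then suc zero else zero

-- The set of values of `g` below `m` as a bit string, hence one of `2 ^ m` codes.
image : ∀ {n} m → (Fin n → ℕ) → Fin (2 ^ m)
image m g = funToFin {m} {2} (occupied g)

image-reflects : ∀ {n} m (g h : Fin n → ℕ) → (∀ v → g v < m) → image m g ≡ image m h → ∀ v → ∃[ u ] h u ≡ g v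
image-reflects m g h g<m eq v = occupant (any? λ u → g u ≟ toℕ i) (any? λ u → h u ≟ toℕ i)
  (trans (sym (finToFun-funToFin (occupied g) i))
    (trans (cong (λ k → finToFun {2} {m} k i) eq) (finToFun-funToFin (occupied h) i)))
  where
  i : Fin m
  i = fromℕ< (g<m v)
  gv≡i : g v ≡ toℕ i
  gv≡i = sym (toℕ-fromℕ< (g<m v))
  occupant : (p : Dec (∃[ u ] g u ≡ toℕ i)) (q : Dec (∃[ u ] h u ≡ toℕ i)) →
    (if does p then suc (zero {0}) else zero) ≡ (if does q then suc zero else zero) → ∃[ u ] h u ≡ g v
  occupant _       (yes (u , hu≡i)) _  = u , trans hu≡i (sym gv≡i)
  occupant (yes _) (no _)           ()
  occupant (no ¬p) (no _)           _  = contradiction (v , gv≡i) ¬p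

module _ {n : ℕ} {G : DAG n} where
  open DAG G using (Arc)
  open Setoid (topologicalOrders G) using (_≈_) renaming (sym to ≈-sym; trans to ≈-trans)
  open TopologicalOrder using (isStrictTotalOrder)

  -- The index of the order among the `T` orders and the code form a pair; `determined` makes the
  -- map from choices to pairs injective.
  choices≤orders*codes : ∀ {T M} → G hasTopologicalOrders T → (l : Fin n → ℕ)
    (order : (∀ v → Fin (2 ^ l v)) → TopologicalOrder G) (code : (∀ v → Fin (2 ^ l v)) → Fin M) →
    (∀ c d → order c ≈ order d → code c ≡ code d → ∀ v → c v ≡ d v) →
    2 ^ sum (tabulate l) ≤ T * M
  choices≤orders*codes {T} {M} orders l order code determined =
    subst (_≤ T * M) (product-2^ l) (injective⇒≤ {f = encode} encode-injective)
    where
    open Inverse orders using (from; strictlyInverseˡ)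
    size : Fin n → ℕ
    size v = 2 ^ l v
    choice = digits size
    encode : Fin (product (tabulate size)) → Fin (T * M)
    encode k = combine (from (order (choice k))) (code (choice k))
    from-injective : ∀ P Q → from P ≡ from Q → P ≈ Q
    from-injective P Q eq = ≈-trans {P} {to (from P)} {Q} (≈-sym {to (from P)} {P} (strictlyInverseˡ P))
      (subst (λ i → to i ≈ Q) (sym eq) (strictlyInverseˡ Q))
      where open Inverse orders using (to)
    encode-injective : ∀ {j k} → encode j ≡ encode k → j ≡ k
    encode-injective {j} {k} eq with sameOrder , sameCode ← combine-injective (from (order (choice j))) _ _ _ eq =
      digits-injective size (determined (choice j) (choice k)
        (from-injective (order (choice j)) (order (choice k)) sameOrder) sameCode)

  -- Topological orders induced by numberings that weakly increase along arcs

  module _ (O : TopologicalOrder G) where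
    open TopologicalOrder O using (respectsArcs) renaming (_<_ to _<ᴼ_)
    private
      module O = IsStrictTotalOrder (isStrictTotalOrder O)

    lexLess : (Fin n → ℕ) → Rel (Fin n) 0ℓ
    lexLess f u v = f u < f v ⊎ (f u ≡ f v × u <ᴼ v)

    -- Vertices are sorted by `f`, ties by `O`. An arc whose ends tie is respected because `O`
    -- respects it.
    lexicographic : (f : Fin n → ℕ) → (∀ {u v} → Arc u v → f u ≤ f v) → TopologicalOrder G
    lexicographic f f-mono = record
      { _<_                = lexLess f
      ; isStrictTotalOrder = record
        { isStrictPartialOrder = record
          { isEquivalence = isEquivalence
          ; irrefl        = λ { refl (inj₁ fu<fu) → <-irrefl refl fu<fu ; refl (inj₂ (_ , u<u)) → O.irrefl refl u<u }
          ; trans         = lex-trans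
          ; <-resp-≈      = (λ { refl u<v → u<v }) , (λ { refl u<v → u<v })
          }
        ; compare = lex-compare
        }
      ; respectsArcs = arc-less
      }
      where
      lex-trans : Transitive (lexLess f)
      lex-trans (inj₁ p)       (inj₁ q)       = inj₁ (<-trans p q)
      lex-trans (inj₁ p)       (inj₂ (q , _)) = inj₁ (subst (f _ <_) q p)
      lex-trans (inj₂ (p , _)) (inj₁ q)       = inj₁ (subst (_< f _) (sym p) q)
      lex-trans (inj₂ (p , s)) (inj₂ (q , t)) = inj₂ (trans p q , O.trans s t)

      lex-compare : Trichotomous _≡_ (lexLess f)
      lex-compare u v with <-cmp (f u) (f v)
      ... | tri< fu<fv fu≢fv fu≯fv = tri< (inj₁ fu<fv) (fu≢fv ∘ cong f)
            λ { (inj₁ p) → fu≯fv p ; (inj₂ (p , _)) → fu≢fv (sym p) }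
      ... | tri> fu≮fv fu≢fv fu>fv = tri> (λ { (inj₁ p) → fu≮fv p ; (inj₂ (p , _)) → fu≢fv p }) (fu≢fv ∘ cong f)
            (inj₁ fu>fv)
      ... | tri≈ fu≮fv fu≡fv fu≯fv with O.compare u v
      ... | tri< u<v u≢v u≯v = tri< (inj₂ (fu≡fv , u<v)) u≢v
            λ { (inj₁ p) → fu≯fv p ; (inj₂ (_ , p)) → u≯v p }
      ... | tri≈ u≮v u≡v u≯v = tri≈ (λ { (inj₁ p) → fu≮fv p ; (inj₂ (_ , p)) → u≮v p }) u≡v
            λ { (inj₁ p) → fu≯fv p ; (inj₂ (_ , p)) → u≯v p }
      ... | tri> u≮v u≢v u>v = tri> (λ { (inj₁ p) → fu≮fv p ; (inj₂ (_ , p)) → u≮v p }) u≢v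
            (inj₂ (sym fu≡fv , u>v))

      arc-less : ∀ {u v} → Arc u v → lexLess f u v
      arc-less uv with m≤n⇒m<n∨m≡n (f-mono uv)
      ... | inj₁ fu<fv = inj₁ fu<fv
      ... | inj₂ fu≡fv = inj₂ (fu≡fv , respectsArcs uv)

    lexLess⇒≤ : ∀ f {u v} → lexLess f u v → f u ≤ f v
    lexLess⇒≤ f (inj₁ fu<fv)       = <⇒≤ fu<fv
    lexLess⇒≤ f (inj₂ (fu≡fv , _)) = ≤-reflexive fu≡fv

  -- Ranks, and increasing functions determined by their images

  rank : TopologicalOrder G → Fin n → ℕ
  rank P v = sum (tabulate λ u → indicator (IsStrictTotalOrder._<?_ (isStrictTotalOrder P) u v))

  module _ (P : TopologicalOrder G) where
    open TopologicalOrder P using () renaming (_<_ to _<ᴾ_)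
    private
      module P = IsStrictTotalOrder (isStrictTotalOrder P)

    rank-strictMono : ∀ {u v} → u <ᴾ v → rank P u < rank P v
    rank-strictMono {u} {v} u<v = sum-mono-<
      (λ x → indicator-mono (x P.<? u) (x P.<? v) (λ x<u → P.trans x<u u<v))
      u (indicator-< (u P.<? u) (u P.<? v) (P.irrefl refl) u<v)

    rank<n : ∀ v → rank P v < n
    rank<n v = subst (rank P v <_) (sum-const-1 n) (sum-mono-<
      (λ x → indicator-≤1 (x P.<? v))
      v (indicator-< (v P.<? v) (yes refl) (P.irrefl refl) (refl {x = v})))

    rank-mono-≈ : ∀ Q → P ≈ Q → ∀ v → rank P v ≤ rank Q v
    rank-mono-≈ Q (P⇒Q , _) v = sum-mono-≤ λ u → indicator-mono (u P.<? v) (IsStrictTotalOrder._<?_ (isStrictTotalOrder Q) u v) P⇒Q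

    -- Strong induction on `g v`. If `h v` were `g u` with `u` before `v`, then `h u = g u = h v`
    -- would contradict monotonicity; so `h v` is a value of `g` at `v` or later, which gives
    -- `g v ≤ h v`. The other inequality is similar.
    strictMono-image-injective : (g h : Fin n → ℕ) →
      (∀ {u v} → u <ᴾ v → g u < g v) → (∀ {u v} → u <ᴾ v → h u < h v) →
      (∀ v → ∃[ u ] h u ≡ g v) → (∀ v → ∃[ u ] g u ≡ h v) → ∀ v → g v ≡ h v
    strictMono-image-injective g h g-mono h-mono g⊆h h⊆g v = go v (<-wellFounded (g v))
      where
      go : ∀ v → Acc _<_ (g v) → g v ≡ h v
      go v (acc rec) = ≤-antisym (below (h⊆g v)) (above (g⊆h v))
        where
        below : ∃[ u ] g u ≡ h v → g v ≤ h v
        below (u , gu≡hv) with P.compare u v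
        ... | tri< u<v _ _ = contradiction (trans (sym (go u (rec (g-mono u<v)))) gu≡hv) (<⇒≢ (h-mono u<v))
        ... | tri≈ _ refl _ = ≤-reflexive gu≡hv
        ... | tri> _ _ v<u = ≤-trans (<⇒≤ (g-mono v<u)) (≤-reflexive gu≡hv)
        above : ∃[ u ] h u ≡ g v → h v ≤ g v
        above (u , hu≡gv) with P.compare u v
        ... | tri< u<v _ _ = contradiction (trans (go u (rec (g-mono u<v))) hu≡gv) (<⇒≢ (g-mono u<v))
        ... | tri≈ _ refl _ = ≤-reflexive hu≡gv
        ... | tri> _ _ v<u = ≤-trans (<⇒≤ (h-mono v<u)) (≤-reflexive hu≡gv)

  -- Every choice of a point a v + c v in the interval of v induces a topological order; adding
  -- the ranks turns the chosen points into an n-subset of [0 , 2n), which gives them back.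
  intervals-bound : ∀ {T} .{{_ : NonZero T}} → G hasTopologicalOrders T → TopologicalOrder G → (a w : Fin n → ℕ) →
    (∀ v → 1 ≤ w v) → (∀ v → a v + w v ≤ n) → (∀ {u v} → Arc u v → a u + w u ≤ a v) →
    sum (tabulate λ v → ⌈log₂ w v ⌉) ≤ 3 * n + ⌊log₂ T ⌋
  intervals-bound {T} orders O a w 1≤w a+w≤n separated = begin
    sum (tabulate λ v → ⌈log₂ w v ⌉)                  ≤⟨ sum-mono-≤ (λ v → n≤1+pred ⌈log₂ w v ⌉) ⟩
    sum (tabulate λ v → 1 + l v)                      ≡⟨ sum-distrib-+ (λ _ → 1) l ⟩
    sum (tabulate {n = n} (λ _ → 1)) + sum (tabulate l) ≤⟨ +-mono-≤ (≤-reflexive (sum-const-1 n))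
                                                       (2^≤*2^⇒≤log₂+ T (choices≤orders*codes orders l order code determined)) ⟩
    n + (⌊log₂ T ⌋ + (n + n))                         ≡⟨ rearrange n ⌊log₂ T ⌋ ⟩
    3 * n + ⌊log₂ T ⌋                                 ∎
    where
    open ≤-Reasoning
    n≤1+pred : ∀ k → k ≤ 1 + pred k
    n≤1+pred zero    = z≤n
    n≤1+pred (suc k) = ≤-refl
    rearrange : ∀ k t → k + (t + (k + k)) ≡ 3 * k + t
    rearrange = solve-∀
    l : Fin n → ℕ
    l v = pred ⌈log₂ w v ⌉
    Choice = ∀ v → Fin (2 ^ l v)
    point : Choice → Fin n → ℕ
    point c v = a v + toℕ (c v)
    point<a+w : ∀ c v → point c v < a v + w v
    point<a+w c v = +-monoʳ-< (a v) (<-≤-trans (toℕ<n (c v)) (2^pred⌈log₂⌉≤ (w v) (1≤w v)))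
    point-mono : ∀ c {u v} → Arc u v → point c u ≤ point c v
    point-mono c {u} {v} uv = ≤-trans (<⇒≤ (point<a+w c u)) (≤-trans (separated uv) (m≤m+n (a v) _))
    order : Choice → TopologicalOrder G
    order c = lexicographic O (point c) (point-mono c)
    shifted : Choice → Fin n → ℕ
    shifted c v = point c v + rank (order c) v
    shifted<2n : ∀ c v → shifted c v < n + n
    shifted<2n c v = +-mono-< (<-≤-trans (point<a+w c v) (a+w≤n v)) (rank<n (order c) v)
    shifted-mono : ∀ c {u v} → lexLess O (point c) u v → shifted c u < shifted c v
    shifted-mono c u<v = +-mono-≤-< (lexLess⇒≤ O (point c) u<v) (rank-strictMono (order c) u<v)
    code : Choice → Fin (2 ^ (n + n))
    code c = image (n + n) (shifted c)
    determined : ∀ c d → order c ≈ order d → code c ≡ code d → ∀ v → c v ≡ d v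
    -- Equal orders have equal ranks; cancelling these and `a v` from the equal shifted points
    -- leaves the choices.
    determined c d c≈d sameCode v = toℕ-injective (+-cancelˡ-≡ (a v) _ _ (+-cancelʳ-≡ (rank (order c) v) _ _
      (trans sameShifted (cong (point d v +_) (sym sameRank)))))
      where
      sameRank : rank (order c) v ≡ rank (order d) v
      sameRank = ≤-antisym (rank-mono-≈ (order c) (order d) c≈d v)
        (rank-mono-≈ (order d) (order c) (≈-sym {order c} {order d} c≈d) v)
      sameShifted : shifted c v ≡ shifted d v
      -- Both functions increase along `order c`, since `order d` relates the same pairs, and equal
      -- codes mean equal images.
      sameShifted = strictMono-image-injective (order c) (shifted c) (shifted d)
        (shifted-mono c) (λ u<v → shifted-mono d (proj₁ c≈d u<v))
        (image-reflects (n + n) (shifted c) (shifted d) (shifted<2n c) sameCode)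
        (image-reflects (n + n) (shifted d) (shifted c) (shifted<2n d) (sym sameCode)) v

-- Isolated vertices

_∈?_ : ∀ {n} (v : Fin n) vs → Dec (v ∈ vs)
_∈?_ = member? Fin._≟_

sum-indicator-≡ : ∀ {n} (x : Fin n) → sum (tabulate λ v → indicator (v Fin.≟ x)) ≤ 1
sum-indicator-≡ {suc n} zero    = ≤-reflexive (cong suc (sum-zero n))
sum-indicator-≡ {suc n} (suc x) = ≤-trans (sum-mono-≤ λ v →
  indicator-mono (suc v Fin.≟ suc x) (v Fin.≟ x) λ { refl → refl }) (sum-indicator-≡ x)

absent : ∀ {n} → List (Fin n) → Fin n → ℕ
absent vs v = if does (v ∈? vs) then 0 else 1

-- Each entry makes at most one more vertex present. Repeated entries only weaken the bound, so
-- endpoints shared by several arcs need no care.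
n≤absent+length : ∀ {n} (vs : List (Fin n)) → n ≤ sum (tabulate (absent vs)) + length vs
n≤absent+length {n} []       = ≤-reflexive (sym (trans (+-identityʳ _) (sum-const-1 n)))
n≤absent+length {n} (x ∷ vs) = begin
  n                                              ≤⟨ n≤absent+length vs ⟩
  sum (tabulate (absent vs)) + length vs         ≤⟨ +-monoˡ-≤ (length vs) (sum-mono-≤ pointwise) ⟩
  sum (tabulate (λ v → absent (x ∷ vs) v + indicator (v Fin.≟ x))) + length vs
    ≡⟨ cong (_+ length vs) (sum-distrib-+ (absent (x ∷ vs)) _) ⟩
  sum (tabulate (absent (x ∷ vs))) + sum (tabulate (λ v → indicator (v Fin.≟ x))) + length vs
    ≤⟨ +-monoˡ-≤ (length vs) (+-monoʳ-≤ (sum (tabulate (absent (x ∷ vs)))) (sum-indicator-≡ x)) ⟩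
  sum (tabulate (absent (x ∷ vs))) + 1 + length vs ≡⟨ +-assoc (sum (tabulate (absent (x ∷ vs)))) 1 _ ⟩
  sum (tabulate (absent (x ∷ vs))) + suc (length vs) ∎
  where
  open ≤-Reasoning
  pointwise : ∀ v → absent vs v ≤ absent (x ∷ vs) v + indicator (v Fin.≟ x)
  pointwise v with v ∈? vs | v Fin.≟ x
  ... | yes _ | _     = z≤n
  ... | no _  | no _  = s≤s z≤n
  ... | no _  | yes _ = s≤s z≤n

module _ {n : ℕ} {G : DAG n} where
  open DAG G using (Arc; arcs; #arcs)
  open Setoid (topologicalOrders G) using (_≈_)

  endpoints : List (Fin n)
  endpoints = map proj₁ arcs ++ map proj₂ arcs

  -- Each isolated vertex other than the pivot can be put before or after the pivot.
  2^isolated≤orders : ∀ {T} → G hasTopologicalOrders T → TopologicalOrder G → (pivot : Fin n) →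
    2 ^ sum (tabulate (absent (pivot ∷ endpoints))) ≤ T * 2 ^ 0
  2^isolated≤orders {T} orders O pivot =
    choices≤orders*codes orders l order (λ _ → zero) determined
    where
    l : Fin n → ℕ
    l = absent (pivot ∷ endpoints)
    Choice = ∀ v → Fin (2 ^ l v)
    -- Isolated vertices go to 0 or 2, all others to 1: the ends of an arc tie, but no isolated
    -- vertex other than the pivot ties with the pivot. Abstracting the decision `p` lets the type
    -- of the choice compute on a case split.
    side : ∀ {P : Set} (p : Dec P) → Fin (2 ^ (if does p then 0 else 1)) → ℕ
    side (yes _) _ = 1
    side (no _)  c = 2 * toℕ c
    side-fixed : ∀ {P : Set} (p : Dec P) c → P → side p c ≡ 1
    side-fixed (yes _) _ _ = refl
    side-fixed (no ¬p) _ p = contradiction p ¬p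
    position : Choice → Fin n → ℕ
    position c v = side (v ∈? (pivot ∷ endpoints)) (c v)
    position-fixed : ∀ c {v} → v ∈ pivot ∷ endpoints → position c v ≡ 1
    position-fixed c {v} v∈ = side-fixed (v ∈? (pivot ∷ endpoints)) (c v) v∈
    position-mono : ∀ c {u v} → Arc u v → position c u ≤ position c v
    position-mono c uv = ≤-reflexive (trans
      (position-fixed c (there (∈-++⁺ˡ (∈-map⁺ proj₁ uv))))
      (sym (position-fixed c (there (∈-++⁺ʳ (map proj₁ arcs) (∈-map⁺ proj₂ uv))))))
    order : Choice → TopologicalOrder G
    order c = lexicographic O (position c) (position-mono c)
    side-determined : ∀ {P : Set} (p : Dec P) c d → (side p c < 1 → side p d ≤ 1) → (side p d < 1 → side p c ≤ 1) → c ≡ d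
    side-determined (yes _) zero       zero       _ _ = refl
    side-determined (no _)  zero       zero       _ _ = refl
    side-determined (no _)  (suc zero) (suc zero) _ _ = refl
    side-determined (no _)  zero       (suc zero) f _ = contradiction (f (s≤s z≤n)) λ { (s≤s ()) }
    side-determined (no _)  (suc zero) zero       _ f = contradiction (f (s≤s z≤n)) λ { (s≤s ()) }
    -- A vertex at 0 precedes the pivot in one order, hence in the other, which excludes position 2
    -- there.
    before-pivot : ∀ c d → (∀ {u v} → lexLess {G = G} O (position c) u v → lexLess {G = G} O (position d) u v) →
      ∀ v → position c v < 1 → position d v ≤ 1
    before-pivot c d c⇒d v cv<1 = subst (position d v ≤_) (position-fixed d (here refl))
      (lexLess⇒≤ {G = G} O (position d) {v} {pivot} (c⇒d {v} {pivot} (inj₁ (subst (position c v <_) (sym (position-fixed c (here refl))) cv<1))))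
    determined : ∀ c d → order c ≈ order d → zero {n = 0} ≡ zero → ∀ v → c v ≡ d v
    determined c d (c⇒d , d⇒c) _ v = side-determined (v ∈? (pivot ∷ endpoints)) (c v) (d v)
      (before-pivot c d c⇒d v) (before-pivot d c d⇒c v)

  vertices-bound : ∀ {T} .{{_ : NonZero T}} → G hasTopologicalOrders T → TopologicalOrder G →
    n ≤ 1 + 2 * #arcs + ⌊log₂ T ⌋
  vertices-bound {T} orders O = fromPivot λ pivot → begin
    n                                                  ≤⟨ n≤absent+length (pivot ∷ endpoints) ⟩
    sum (tabulate (absent (pivot ∷ endpoints))) + suc (length endpoints)
      ≤⟨ +-mono-≤ (2^≤*2^⇒≤log₂+ T (2^isolated≤orders orders O pivot)) (≤-reflexive (cong suc length-endpoints)) ⟩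
    ⌊log₂ T ⌋ + 0 + suc (#arcs + #arcs)                ≡⟨ rearrange ⌊log₂ T ⌋ #arcs ⟩
    1 + 2 * #arcs + ⌊log₂ T ⌋                          ∎
    where
    open ≤-Reasoning
    -- Without vertices there is no pivot, but then nothing is to be shown.
    fromPivot : ∀ {k b} → (Fin k → k ≤ b) → k ≤ b
    fromPivot {zero}  _ = z≤n
    fromPivot {suc k} f = f zero
    rearrange : ∀ t m → t + 0 + suc (m + m) ≡ 1 + 2 * m + t
    rearrange = solve-∀
    length-endpoints : length endpoints ≡ #arcs + #arcs
    length-endpoints = trans (length-++ (map proj₁ arcs)) (cong₂ _+_ (length-map proj₁ arcs) (length-map proj₂ arcs))

-- Duplicate-free lists and permutations

Unique-resp-↭ : ∀ {A : Set} {xs ys : List A} → xs ↭ ys → Unique xs → Unique ys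
Unique-resp-↭ {A} p = ↭ₛ.Unique-resp-↭ (setoid A) (↭⇒↭ₛ p)

Unique-++-disjoint : ∀ {A : Set} {x : A} xs {ys} → Unique (xs ++ ys) → x ∈ xs → x ∉ ys
Unique-++-disjoint (x ∷ xs) (x∉ ∷ _) (here refl) x∈ys = All.lookup x∉ (∈-++⁺ʳ xs x∈ys) refl
Unique-++-disjoint (_ ∷ xs) (_ ∷ u)  (there x∈)  x∈ys = Unique-++-disjoint xs u x∈ x∈ys

∈⇒↭∷ : ∀ {A : Set} {x : A} {xs} → x ∈ xs → ∃[ ys ] xs ↭ x ∷ ys
∈⇒↭∷ x∈xs with ys , zs , refl ← ∈-∃++ x∈xs = ys ++ zs , shift _ ys zs

-- Logs, degrees and adjacency lists

module _ {n : ℕ} where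
  private
    V = Fin n

  -- vs is listed most recent element first, so a v counts the elements before v.
  data Numbers (a : V → ℕ) : List V → Set where
    []  : Numbers a []
    _∷_ : ∀ {v vs} → a v ≡ length vs → Numbers a vs → Numbers a (v ∷ vs)

  Numbers-cong : ∀ {a b} → (vs : List V) → (∀ {v} → v ∈ vs → b v ≡ a v) → Numbers a vs → Numbers b vs
  Numbers-cong []       _  []       = []
  Numbers-cong (v ∷ vs) eq (p ∷ ps) = trans (eq (here refl)) p ∷ Numbers-cong vs (eq ∘ there) ps

  position : List V → V → ℕ
  position []       v = 0
  position (x ∷ vs) v = if does (v Fin.≟ x) then length vs else position vs v

  position-numbers : ∀ {vs} → Unique vs → Numbers (position vs) vs
  position-numbers []                        = []
  position-numbers {x ∷ vs} (x∉vs ∷ unique) = first ∷ Numbers-cong vs rest (position-numbers unique)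
    where
    first : position (x ∷ vs) x ≡ length vs
    first with x Fin.≟ x
    ... | yes _   = refl
    ... | no x≢x = contradiction refl x≢x
    rest : ∀ {v} → v ∈ vs → position (x ∷ vs) v ≡ position vs v
    rest {v} v∈vs with v Fin.≟ x
    ... | yes v≡x = contradiction (sym v≡x) (All.lookup x∉vs v∈vs)
    ... | no _    = refl

  keys : List (V × ℕ) → List V
  keys = map proj₁

  valueAt : List (V × ℕ) → V → ℕ
  valueAt []            v = 0
  valueAt ((x , k) ∷ D) v = if does (v Fin.≟ x) then k else valueAt D v

  valueAt-∈ : ∀ D → Unique (keys D) → All (λ (v , k) → valueAt D v ≡ k) D
  valueAt-∈ []            []            = []
  valueAt-∈ ((x , k) ∷ D) (x∉ ∷ unique) = first ∷ All.tabulate rest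
    where
    first : valueAt ((x , k) ∷ D) x ≡ k
    first with x Fin.≟ x
    ... | yes _   = refl
    ... | no x≢x = contradiction refl x≢x
    rest : ∀ {e} → e ∈ D → valueAt ((x , k) ∷ D) (proj₁ e) ≡ proj₂ e
    rest {v , _} e∈D with v Fin.≟ x
    ... | yes v≡x = contradiction (sym v≡x) (All.lookup x∉ (∈-map⁺ proj₁ e∈D))
    ... | no _    = All.lookup (valueAt-∈ D unique) e∈D

  occurrences : V → List V → ℕ
  occurrences v vs = length (filter (v Fin.≟_) vs)

  occurrences≡0⇒∉ : ∀ {v} vs → occurrences v vs ≡ 0 → v ∉ vs
  occurrences≡0⇒∉ {v} vs none v∈vs = <⇒≢ (filter-some (v Fin.≟_) v∈vs) (sym none)

  ∉⇒occurrences≡0 : ∀ {v vs} → v ∉ vs → occurrences v vs ≡ 0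
  ∉⇒occurrences≡0 {v} v∉vs = cong length (filter-none (v Fin.≟_) (All.¬Any⇒All¬ _ v∉vs))

  occurrences-here : ∀ v vs → occurrences v (v ∷ vs) ≡ suc (occurrences v vs)
  occurrences-here v vs = cong length (filter-accept (v Fin.≟_) refl)

  occurrences-there : ∀ {v x} vs → v ≢ x → occurrences v (x ∷ vs) ≡ occurrences v vs
  occurrences-there {v} vs v≢x = cong length (filter-reject (v Fin.≟_) v≢x)

  -- `ts` will list the heads of the arcs not yet deleted, with multiplicity, so these counts are
  -- the in-degrees of the remaining graph.
  Degrees : Vec ℕ n → List V → Set
  Degrees deg ts = ∀ w → lookup deg w ≡ occurrences w ts

  Degrees-remove : ∀ {deg} w ts → Degrees deg (w ∷ ts) → Degrees (deg [ w ]≔ pred (lookup deg w)) ts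
  Degrees-remove {deg} w ts degrees u with u Fin.≟ w
  ... | yes refl = trans (lookup∘update w deg _)
                     (cong pred (trans (degrees w) (occurrences-here w ts)))
  ... | no u≢w   = trans (lookup∘update′ u≢w deg _) (trans (degrees u) (occurrences-there ts u≢w))

  Degrees-add : ∀ {deg} w {ts us} → us ↭ w ∷ ts → Degrees deg ts → Degrees (deg [ w ]≔ suc (lookup deg w)) us
  Degrees-add {deg} w {ts} {us} us↭ degrees u = trans incremented (sym (↭-length (filter-↭ (u Fin.≟_) us↭)))
    where
    incremented : lookup (deg [ w ]≔ suc (lookup deg w)) u ≡ occurrences u (w ∷ ts)
    incremented with u Fin.≟ w
    ... | yes refl = trans (lookup∘update w deg _) (cong suc (degrees w))
    ... | no u≢w   = trans (lookup∘update′ u≢w deg _) (degrees u)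

  targets : List V → Vec (List V) n → List V
  targets xs out = concatMap (lookup out) xs

  targets-frame : ∀ {x} xs out {ws} → x ∉ xs → targets xs (out [ x ]≔ ws) ≡ targets xs out
  targets-frame []       out x∉ = refl
  targets-frame (y ∷ xs) out x∉ = cong₂ _++_
    (lookup∘update′ (λ y≡x → x∉ (here (sym y≡x))) out _) (targets-frame xs out (x∉ ∘ there))

  targets-add : ∀ {v} xs out w → Unique xs → v ∈ xs →
    targets xs (out [ v ]≔ (w ∷ lookup out v)) ↭ w ∷ targets xs out
  targets-add {v} (_ ∷ xs) out w (v∉xs ∷ _) (here refl)
    rewrite lookup∘update v out (w ∷ lookup out v)
          | targets-frame xs out {w ∷ lookup out v} (λ v∈xs → All.lookup v∉xs v∈xs refl) = ↭-refl
  targets-add {v} (y ∷ xs) out w (y∉xs ∷ unique) (there v∈xs)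
    rewrite lookup∘update′ (All.lookup y∉xs v∈xs) out (w ∷ lookup out v) =
    ↭-trans (++⁺ˡ (lookup out y) (targets-add xs out w unique v∈xs)) (shift w (lookup out y) _)

  ∈-targets⁺ : ∀ {v w} xs out → v ∈ xs → w ∈ lookup out v → w ∈ targets xs out
  ∈-targets⁺ xs out v∈xs w∈ = ∈-concatMap⁺ (lookup out) (lose v∈xs w∈)

  ∈-targets⁻ : ∀ {w} xs out → w ∈ targets xs out → ∃[ v ] (v ∈ xs × w ∈ lookup out v)
  ∈-targets⁻ xs out w∈ = find (∈-concatMap⁻ (lookup out) w∈)

-- Schedules of heap operations

module Schedule {n : ℕ} (G : DAG n) (O : TopologicalOrder G) where
  open DAG G using (Arc)
  open TopologicalOrder O public using (isStrictTotalOrder; respectsArcs) renaming (_<_ to _≺_)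
  module ≺ = IsStrictTotalOrder isStrictTotalOrder

  V = Fin n

  workingSetSize : V → List V → ℕ
  workingSetSize x past = length (workingSet ≺._≟_ x past)

  -- The deleted vertices with the sizes of their working sets and the inserted vertices, both
  -- most recent first, and the contents of the heap.
  record Config : Set where
    constructor ⟨_,_,_⟩
    field
      log      : List (V × ℕ)
      past     : List V
      contents : List V

  open Config public

  initial : Config
  initial = ⟨ [] , [] , [] ⟩

  -- `inserts` records that all in-neighbours have been deleted, the one fact about the graph that
  -- separates the intervals. `deletes` stores the size of the working set, which depends on the
  -- past at that moment.
  data Steps : Config → List (Event V) → Config → Set where
    []       : ∀ {c} → Steps c [] c
    inserts  : ∀ {D I p u es c} → u ∉ I → (∀ {v} → Arc v u → v ∈ keys D) →
               Steps ⟨ D , u ∷ I , u ∷ p ⟩ es c → Steps ⟨ D , I , p ⟩ (inserted u ∷ es) c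
    deletes  : ∀ {D I p x r es c} → p ↭ x ∷ r → All (x ≺_) r →
               Steps ⟨ (x , workingSetSize x I) ∷ D , I , r ⟩ es c → Steps ⟨ D , I , p ⟩ (deleted x ∷ es) c

  _++ˢ_ : ∀ {c d e es fs} → Steps c es d → Steps d fs e → Steps c (es ++ fs) e
  []                  ++ˢ t = t
  inserts fresh arcs s ++ˢ t = inserts fresh arcs (s ++ˢ t)
  deletes p↭ min s    ++ˢ t = deletes p↭ min (s ++ˢ t)

  record Balanced (c : Config) : Set where
    constructor _,_
    field
      past-unique : Unique (past c)
      past-↭      : past c ↭ contents c ++ keys (log c)

  open Balanced public

  Balanced-insert : ∀ {D I p u} → u ∉ I → Balanced ⟨ D , I , p ⟩ → Balanced ⟨ D , u ∷ I , u ∷ p ⟩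
  Balanced-insert u∉I (unique , I↭) = All.¬Any⇒All¬ _ u∉I ∷ unique , prep _ I↭

  Balanced-delete : ∀ {D I p x r k} → p ↭ x ∷ r → Balanced ⟨ D , I , p ⟩ → Balanced ⟨ (x , k) ∷ D , I , r ⟩
  Balanced-delete {D} {x = x} {r} p↭ (unique , I↭) =
    unique , ↭-trans I↭ (↭-trans (++⁺ʳ (keys D) p↭) (↭-sym (shift x r (keys D))))

  Steps-balanced : ∀ {c es d} → Steps c es d → Balanced c → Balanced d
  Steps-balanced []                  b = b
  Steps-balanced (inserts fresh _ s) b = Steps-balanced s (Balanced-insert fresh b)
  Steps-balanced (deletes p↭ _ s)    b = Steps-balanced s (Balanced-delete p↭ b)

  initial-balanced : Balanced initial
  initial-balanced = [] , ↭-refl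

  Steps-transitions : ∀ {c es d} → Steps c es d → Transitions _≺_ (contents c) es (contents d)
  Steps-transitions []               = []
  Steps-transitions (inserts _ _ s)  = inserting (Steps-transitions s)
  Steps-transitions (deletes p↭ m s) = deleting p↭ m (Steps-transitions s)

  Steps-insertions : ∀ {c es d} → Steps c es d → Unique (insertions es) × All (_∉ past c) (insertions es)
  Steps-insertions []                  = [] , []
  Steps-insertions (inserts fresh _ s) with unique , new ← Steps-insertions s =
    All.map (λ x∉ u≡x → x∉ (here (sym u≡x))) new ∷ unique , fresh ∷ All.map (λ x∉ → x∉ ∘ there) new
  Steps-insertions (deletes _ _ s)     = Steps-insertions s

  Steps-history : ∀ {es c} → Steps initial es c → History _≺_ es (contents c)
  Steps-history s = record
    { transitions  = Steps-transitions s
    ; insertedOnce = proj₁ (Steps-insertions s)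
    }

  -- The numbering is fixed by the complete past. Earlier pasts are suffixes of it, so the same
  -- numbering is right at every earlier time.
  Numbers-past : ∀ {a c es d} → Steps c es d → Numbers a (past d) → Numbers a (past c)
  Numbers-past []              ns = ns
  Numbers-past (inserts _ _ s) ns with Numbers-past s ns
  ... | _ ∷ ns′ = ns′
  Numbers-past (deletes _ _ s) ns = Numbers-past s ns

  All-log : ∀ {P : V × ℕ → Set} {c es d} → Steps c es d → All P (log d) → All P (log c)
  All-log []              ps = ps
  All-log (inserts _ _ s) ps = All-log s ps
  All-log (deletes _ _ s) ps = All.tail (All-log s ps)

  workingSetSize-≥1 : ∀ {x I} → x ∈ I → 1 ≤ workingSetSize x I
  workingSetSize-≥1 {I = _ ∷ _} _ = s≤s z≤n

  -- `workingSet` walks back from the latest insertion down to `x`, through all positions from `a x`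
  -- on.
  position+workingSetSize : ∀ {a x I} → Numbers a I → x ∈ I → a x + workingSetSize x I ≡ length I
  position+workingSetSize {a} {x} {y ∷ I} (ay ∷ ns) x∈ with x ≺.≟ y
  ... | yes refl = trans (cong (_+ 1) ay) (+-comm (length I) 1)
  ... | no x≢y with x∈
  ...   | here x≡y  = contradiction x≡y x≢y
  ...   | there x∈I = trans (+-suc (a x) _) (cong suc (position+workingSetSize ns x∈I))

  -- The current time is the length of `past`. `finished` makes `separated` inductive: a vertex
  -- inserted now starts at the current time, when the intervals of its deleted in-neighbours have
  -- ended.
  record Separated (a w : V → ℕ) (c : Config) : Set where
    field
      nonempty  : ∀ {v} → v ∈ keys (log c) → 1 ≤ w v
      finished  : ∀ {v} → v ∈ keys (log c) → a v + w v ≤ length (past c)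
      separated : ∀ {v u} → u ∈ past c → Arc v u → a v + w v ≤ a u

  open Separated public

  initial-separated : ∀ {a w} → Separated a w initial
  initial-separated = record { nonempty = λ () ; finished = λ () ; separated = λ () }

  Steps-separated : ∀ {a w c es d} → Steps c es d → Numbers a (past d) → All (λ (v , k) → w v ≡ k) (log d) →
    Balanced c → Separated a w c → Separated a w d
  Steps-separated [] _ _ _ sep = sep
  Steps-separated {a} {w} (inserts {D} {I} {u = u} fresh arcs s) ns ws b sep =
    Steps-separated s ns ws (Balanced-insert fresh b) record
      { nonempty  = nonempty sep
      ; finished  = λ v∈ → m≤n⇒m≤1+n (finished sep v∈)
      ; separated = separated′
      }
    where
    separated′ : ∀ {v t} → t ∈ u ∷ I → Arc v t → a v + w v ≤ a t
    separated′ (here refl) vu with Numbers-past s ns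
    ... | au ∷ _ = ≤-trans (finished sep (arcs vu)) (≤-reflexive (sym au))
    separated′ (there t∈I) vt = separated sep t∈I vt
  Steps-separated {a} {w} (deletes {D} {I} {p} {x} {r} p↭ _ s) ns ws b sep =
    Steps-separated s ns ws (Balanced-delete p↭ b) record
      { nonempty  = nonempty′
      ; finished  = finished′
      ; separated = separated sep
      }
    where
    x∈I : x ∈ I
    x∈I = ∈-resp-↭ (↭-sym (past-↭ b)) (∈-++⁺ˡ (∈-resp-↭ (↭-sym p↭) (here refl)))
    wx : w x ≡ workingSetSize x I
    wx = All.head (All-log s ws)
    nonempty′ : ∀ {v} → v ∈ x ∷ keys D → 1 ≤ w v
    nonempty′ (here refl) = subst (1 ≤_) (sym wx) (workingSetSize-≥1 x∈I)
    nonempty′ (there v∈)  = nonempty sep v∈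
    finished′ : ∀ {v} → v ∈ x ∷ keys D → a v + w v ≤ length I
    finished′ (here refl) = ≤-reflexive (trans (cong (a x +_) wx) (position+workingSetSize (Numbers-past s ns) x∈I))
    finished′ (there v∈)  = finished sep v∈

  -- Total charge of a schedule

  module _ (cf ci cd : ℕ) where

    deletionCost : ℕ → ℕ
    deletionCost k = cd * (1 + ⌈log₂ k ⌉)

    -- The charges so far as a function of the configuration: the sum over events telescopes, and
    -- what remains is a sum over deleted vertices.
    account : Config → ℕ
    account c = ci * length (past c) + sum (map (deletionCost ∘ proj₂) (log c))

    Steps-timeBounds : ∀ {c es d} → Steps c es d →
      sum (timeBoundsFrom cf ci cd ≺._≟_ (past c) es) + account c ≡ account d
    Steps-timeBounds [] = refl
    Steps-timeBounds (inserts {D} {I} {es = es} _ _ s) = trans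
      (rearrange ci (sum (timeBoundsFrom cf ci cd ≺._≟_ (_ ∷ I) es)) (length I) (sum (map (deletionCost ∘ proj₂) D)))
      (Steps-timeBounds s)
      where
      rearrange : ∀ c t k d → (c + t) + (c * k + d) ≡ t + (c * suc k + d)
      rearrange = solve-∀
    Steps-timeBounds (deletes {D} {I} {x = x} {es = es} _ _ s) = trans
      (rearrange (deletionCost (workingSetSize x I)) (sum (timeBoundsFrom cf ci cd ≺._≟_ I es)) (ci * length I) _)
      (Steps-timeBounds s)
      where
      rearrange : ∀ e t i d → (e + t) + (i + d) ≡ t + (i + (e + d))
      rearrange = solve-∀

  -- In the end every vertex is logged exactly once, so the charges become a sum over vertices.
  -- Insertion positions and logged sizes are the intervals that `intervals-bound` counts.
  timeBounds-bound : ∀ cf ci cd {T} .{{_ : NonZero T}} → G hasTopologicalOrders T →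
    ∀ {es D I} → Steps initial es ⟨ D , I , [] ⟩ → keys D ↭ allFin n →
    sum (timeBounds cf ci cd ≺._≟_ es) ≤ ci * n + cd * (n + (3 * n + ⌊log₂ T ⌋))
  timeBounds-bound cf ci cd {T} orders {es} {D} {I} s D↭ = begin
    sum (timeBounds cf ci cd ≺._≟_ es)                     ≤⟨ m≤m+n _ _ ⟩
    sum (timeBounds cf ci cd ≺._≟_ es) + account cf ci cd initial ≡⟨ Steps-timeBounds cf ci cd s ⟩
    ci * length I + sum (map (cost ∘ proj₂) D)             ≡⟨ cong₂ _+_ (cong (ci *_) |I|≡n) (sum-↭ costs↭) ⟩
    ci * n + sum (tabulate (cost ∘ w))                     ≡⟨ cong (ci * n +_) (sum-distrib-* cd (λ v → 1 + ⌈log₂ w v ⌉)) ⟩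
    ci * n + cd * sum (tabulate λ v → 1 + ⌈log₂ w v ⌉)     ≡⟨ cong (λ t → ci * n + cd * t) (sum-distrib-+ (λ _ → 1) (λ v → ⌈log₂ w v ⌉)) ⟩
    ci * n + cd * (sum (tabulate {n = n} λ _ → 1) + sum (tabulate λ v → ⌈log₂ w v ⌉))
      ≡⟨ cong (λ t → ci * n + cd * (t + sum (tabulate λ v → ⌈log₂ w v ⌉))) (sum-const-1 n) ⟩
    ci * n + cd * (n + sum (tabulate λ v → ⌈log₂ w v ⌉))
      ≤⟨ +-monoʳ-≤ (ci * n) (*-monoʳ-≤ cd (+-monoʳ-≤ n (intervals-bound orders O a w
           (λ v → nonempty sep (∈keys v)) (λ v → subst (a v + w v ≤_) |I|≡n (finished sep (∈keys v)))
           (λ {_} {v} → separated sep (∈-resp-↭ (↭-sym I↭) (∈-allFin v)))))) ⟩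
    ci * n + cd * (n + (3 * n + ⌊log₂ T ⌋))                ∎
    where
    open ≤-Reasoning
    cost = deletionCost cf ci cd
    a = position I
    w = valueAt D
    balanced : Balanced ⟨ D , I , [] ⟩
    balanced = Steps-balanced s initial-balanced
    I↭ : I ↭ allFin n
    I↭ = ↭-trans (past-↭ balanced) D↭
    |I|≡n : length I ≡ n
    |I|≡n = trans (↭-length I↭) (length-tabulate {n = n} id)
    uniqueKeys : Unique (keys D)
    uniqueKeys = Unique-resp-↭ (↭-sym D↭) (allFin⁺ n)
    ∈keys : ∀ v → v ∈ keys D
    ∈keys v = ∈-resp-↭ (↭-sym D↭) (∈-allFin v)
    sep : Separated a w ⟨ D , I , [] ⟩
    sep = Steps-separated s (position-numbers (past-unique balanced)) (valueAt-∈ D uniqueKeys) initial-balanced initial-separated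
    map-cost : ∀ E → All (λ (v , k) → w v ≡ k) E → map (cost ∘ proj₂) E ≡ map (cost ∘ w) (keys E)
    map-cost []      []         = refl
    map-cost (_ ∷ E) (eq ∷ eqs) = cong₂ _∷_ (cong cost (sym eq)) (map-cost E eqs)
    costs↭ : map (cost ∘ proj₂) D ↭ tabulate (cost ∘ w)
    costs↭ = subst₂ _↭_ (sym (map-cost D (valueAt-∈ D uniqueKeys))) (map-tabulate id (cost ∘ w))
      (↭.map⁺ (cost ∘ w) D↭)

-- Computations

module _ {K : Set} (lt : K → K → Bool) where

  run->>= : ∀ {A B} (c : Comp K A) (f : A → Comp K B) {a t q b t′ q′} →
    run lt c ≡ outcome a t q → run lt (f a) ≡ outcome b t′ q′ →
    run lt (c >>= f) ≡ outcome b (t + t′) (q + q′)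
  run->>= (return _)      f refl eq = eq
  run->>= (step c)        f refl eq =
    cong (λ o → outcome (value o) (suc (time o)) (comparisons o)) (run->>= c f refl eq)
  run->>= (compare x y c) f refl eq =
    cong (λ o → outcome (value o) (suc (time o)) (suc (comparisons o))) (run->>= (c (lt x y)) f refl eq)

  comparisons≤time : ∀ {A} (c : Comp K A) → comparisons (run lt c) ≤ time (run lt c)
  comparisons≤time (return _)      = z≤n
  comparisons≤time (step c)        = m≤n⇒m≤1+n (comparisons≤time c)
  comparisons≤time (compare x y c) = s≤s (comparisons≤time (c (lt x y)))

delay : ∀ {A} → ℕ → Outcome A → Outcome A
delay k o = outcome (value o) (k + time o) (comparisons o)

-- A named counterpart of the delay in `newArray`, whose run is computed by induction.
wait : ∀ {K A} → ℕ → A → Comp K A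
wait zero    a = return a
wait (suc k) a = step (wait k a)

wait-run : ∀ {K A} (lt : K → K → Bool) k (a : A) → run lt (wait k a) ≡ outcome a k 0
wait-run lt zero    a = refl
wait-run lt (suc k) a = cong (delay 1) (wait-run lt k a)

-- The cost counter local to newArray has no name outside Defs, so the type of charge≡wait is
-- left to be read off the goal once its hidden argument suc n has been generalised.
mutual
  newArray-suc : ∀ (K A : Set) n (a : A) → newArray {K} (suc n) a ≡ wait (n + 1) (replicate (suc n) a)
  -- The count is written `n + 1` so that abstracting `suc n` does not capture it.
  newArray-suc K A n a with suc n | replicate (suc n) a
  ... | m | as = charge≡wait K A a m as n

  charge≡wait : (K A : Set) (a : A) (m : ℕ) (as : Vec A m) (n : ℕ) → _
  charge≡wait K A a m as zero    = refl
  charge≡wait K A a m as (suc n) = cong step (charge≡wait K A a m as n)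

newArray-run : ∀ {K A} (lt : K → K → Bool) n (a : A) → run lt (newArray n a) ≡ outcome (replicate n a) n 0
newArray-run lt zero    a = refl
newArray-run lt (suc n) a = begin
  run lt (newArray (suc n) a)                ≡⟨ cong (run lt) (newArray-suc _ _ n a) ⟩
  run lt (wait (n + 1) (replicate (suc n) a)) ≡⟨ wait-run lt (n + 1) (replicate (suc n) a) ⟩
  outcome (replicate (suc n) a) (n + 1) 0    ≡⟨ cong (λ t → outcome (replicate (suc n) a) t 0) (+-comm n 1) ⟩
  outcome (replicate (suc n) a) (suc n) 0    ∎
  where open ≡-Reasoning

-- Executions of heap operations

module HeapExecution (H : Heap) {K : Set} (lt : K → K → Bool) where
  open Heap H

  after : State K → List (Event K) → State K
  after s []       = s
  after s (e ∷ es) = after (proj₂ (value (run lt (operate raw e s)))) es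

  heapTime heapComparisons : State K → List (Event K) → ℕ
  heapTime        s es = sum (map (time ∘ proj₂) (executeFrom raw lt s es))
  heapComparisons s es = sum (map (comparisons ∘ proj₂) (executeFrom raw lt s es))

  after-++ : ∀ s es fs → after s (es ++ fs) ≡ after (after s es) fs
  after-++ s []       fs = refl
  after-++ s (e ∷ es) fs = after-++ _ es fs

  executeFrom-++ : ∀ s es fs →
    executeFrom raw lt s (es ++ fs) ≡ executeFrom raw lt s es ++ executeFrom raw lt (after s es) fs
  executeFrom-++ s []       fs = refl
  executeFrom-++ s (e ∷ es) fs = cong (_ ∷_) (executeFrom-++ _ es fs)

  sum-execute-++ : ∀ (f : Event K × Outcome (Maybe K × State K) → ℕ) s es fs →
    sum (map f (executeFrom raw lt s (es ++ fs))) ≡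
    sum (map f (executeFrom raw lt s es)) + sum (map f (executeFrom raw lt (after s es) fs))
  sum-execute-++ f s es fs = begin
    sum (map f (executeFrom raw lt s (es ++ fs)))     ≡⟨ cong (sum ∘ map f) (executeFrom-++ s es fs) ⟩
    sum (map f (executeFrom raw lt s es ++ _))        ≡⟨ cong sum (map-++ f (executeFrom raw lt s es) _) ⟩
    sum (map f (executeFrom raw lt s es) ++ _)        ≡⟨ sum-++ (map f (executeFrom raw lt s es)) _ ⟩
    _                                                 ∎
    where open ≡-Reasoning

  heapComparisons≤heapTime : ∀ s es → heapComparisons s es ≤ heapTime s es
  heapComparisons≤heapTime s []       = z≤n
  heapComparisons≤heapTime s (e ∷ es) =
    +-mono-≤ (comparisons≤time lt (operate raw e s)) (heapComparisons≤heapTime _ es)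

  -- `operate` wraps an insertion to give it an answer. The wrapper is free; the zeros come from it
  -- and from summing over a single event.
  insert-run : ∀ x s → run lt (insert x s) ≡
    outcome (after s (inserted x ∷ [])) (heapTime s (inserted x ∷ [])) (heapComparisons s (inserted x ∷ []))
  insert-run x s = sym (begin
    outcome (proj₂ (value o)) (time o + 0) (comparisons o + 0)
      ≡⟨ cong (λ o′ → outcome (proj₂ (value o′)) (time o′ + 0) (comparisons o′ + 0))
              (run->>= lt (insert x s) (λ s′ → return (nothing , s′)) refl refl) ⟩
    outcome (value o₀) (time o₀ + 0 + 0) (comparisons o₀ + 0 + 0)
      ≡⟨ cong₂ (outcome (value o₀)) (trans (+-identityʳ _) (+-identityʳ _)) (trans (+-identityʳ _) (+-identityʳ _)) ⟩
    o₀ ∎)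
    where
    open ≡-Reasoning
    o  = run lt (operate raw (inserted x) s)
    o₀ = run lt (insert x s)

  -- `c` uses the heap s through the operations es only and spends k further steps.
  record Uses {A : Set} (s : State K) (c : Comp K A) (es : List (Event K)) (a : A) (k : ℕ) : Set where
    constructor uses
    field
      run≡ : run lt c ≡ outcome a (k + heapTime s es) (heapComparisons s es)

  open Uses public

  Uses-cost : ∀ {A s} {c : Comp K A} {es a k l} → k ≡ l → Uses s c es a k → Uses s c es a l
  Uses-cost refl u = u

  Uses-step : ∀ {A s} {c : Comp K A} {es a k} → Uses s c es a k → Uses s (step c) es a (suc k)
  Uses-step (uses eq) = uses (cong (delay 1) eq)

  Uses->>= : ∀ {A B s} {c : Comp K A} {f : A → Comp K B} {es fs a b k l} →
    Uses s c es a k → Uses (after s es) (f a) fs b l → Uses s (c >>= f) (es ++ fs) b (k + l)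
  Uses->>= {s = s} {c} {f} {es} {fs} {b = b} {k} {l} (uses eq) (uses eq′) = uses (trans
    (run->>= lt c f eq eq′)
    (cong₂ (outcome b)
      (trans (rearrange k (heapTime s es) l (heapTime (after s es) fs))
             (cong (k + l +_) (sym (sum-execute-++ (time ∘ proj₂) s es fs))))
      (sym (sum-execute-++ (comparisons ∘ proj₂) s es fs))))
    where
    rearrange : ∀ k t l t′ → (k + t) + (l + t′) ≡ k + l + (t + t′)
    rearrange = solve-∀

  Uses-return : ∀ {A s} {a : A} → Uses s (return a) [] a 0
  Uses-return = uses refl

  Uses-insert : ∀ x s → Uses s (insert x s) (inserted x ∷ []) (after s (inserted x ∷ [])) 0
  Uses-insert x s = uses (insert-run x s)

  Uses-deleteMin : ∀ {x} s → proj₁ (value (run lt (deleteMin s))) ≡ just x →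
    Uses s (deleteMin s) (deleted x ∷ []) (just x , after s (deleted x ∷ [])) 0
  Uses-deleteMin {x} s eq = uses (cong₂ (λ m t → outcome (m , after s (deleted x ∷ [])) (proj₁ t) (proj₂ t)) eq
    (cong₂ _,_ (sym (+-identityʳ _)) (sym (+-identityʳ _))))

-- Runs of topological heapsort

module _ (H : Heap) {n : ℕ} (G : DAG n) (O : TopologicalOrder G) where
  open DAG G using (Arc; arcs; #arcs)
  open Schedule G O
  open Heap H
  open TopologicalHeapsort H {n}

  lt : V → V → Bool
  lt = lessThan isStrictTotalOrder

  open HeapExecution H lt

  -- Heap correctness speaks only of executions from the empty heap, so a state carries a history
  -- leading to it.
  record Reached (s : State V) (c : Config) : Set where
    field
      {events} : List (Event V)
      steps    : Steps initial events c
      state    : after empty events ≡ s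

  open Reached

  Reached-after : ∀ {s c es d} → Reached s c → Steps c es d → Reached (after s es) d
  Reached-after {es = es} r t = record
    { steps = steps r ++ˢ t
    ; state = trans (after-++ empty (events r) es) (cong (λ s → after s es) (state r))
    }

  Reached-balanced : ∀ {s c} → Reached s c → Balanced c
  Reached-balanced r = Steps-balanced (steps r) initial-balanced

  -- Correctness covers histories with any final contents: append the deletion to the history of `s`
  -- and read off the last answer.
  deleteMin-correct : ∀ {s D I p x r} → Reached s ⟨ D , I , p ⟩ → p ↭ x ∷ r → All (x ≺_) r →
    proj₁ (value (run lt (deleteMin s))) ≡ just x
  deleteMin-correct {s} {x = x} reached p↭ min = subst (λ s → proj₁ (value (run lt (deleteMin s))) ≡ just x) (state reached)
    (All.head (All.++⁻ʳ (executeFrom raw lt empty es) (subst (All _) (executeFrom-++ empty es (deleted x ∷ []))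
      (correct isStrictTotalOrder (Steps-history (steps reached ++ˢ deletes p↭ min []))))))
    where es = events reached

  -- `I` holds all vertices ever inserted, not just those in the heap, so deleting the minimum
  -- leaves this equivalence intact; only removing arcs affects it.
  Ready : List V → List V → Set
  Ready I ts = (∀ {w} → w ∈ I → w ∉ ts) × (∀ {w} → w ∉ ts → w ∈ I)

  insertionIf : ℕ → V → List (Event V)
  insertionIf zero    v = inserted v ∷ []
  insertionIf (suc _) v = []

  insertIfSource-uses : ∀ d v s → Uses s (insertIfSource d v s) (insertionIf d v) (after s (insertionIf d v)) 1
  insertIfSource-uses zero    v s = Uses-step (Uses-insert v s)
  insertIfSource-uses (suc d) v s = Uses-step Uses-return

  -- Four steps per arc: tick, read, write and the test for a source. The new degree is a variable
  -- `d` so that the caller can split on it.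
  processArcs-∷ : ∀ s ws deg w {d es r} → pred (lookup deg w) ≡ d →
    Uses (after s (insertionIf d w)) (processArcs ws (deg [ w ]≔ d) (after s (insertionIf d w))) es r (1 + 4 * length ws) →
    Uses s (processArcs (w ∷ ws) deg s) (insertionIf d w ++ es) r (1 + 4 * length (w ∷ ws))
  processArcs-∷ s ws deg w {d} refl rest = Uses-cost (cost (length ws))
    (Uses-step (Uses-step (Uses-step (Uses->>= (insertIfSource-uses d w s) rest))))
    where
    cost : ∀ k → 3 + (1 + (1 + 4 * k)) ≡ 1 + 4 * suc k
    cost = solve-∀

  insertSources-∷ : ∀ s vs deg w {d es r} → lookup deg w ≡ d →
    Uses (after s (insertionIf d w)) (insertSources vs deg (after s (insertionIf d w))) es r (1 + 3 * length vs) →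
    Uses s (insertSources (w ∷ vs) deg s) (insertionIf d w ++ es) r (1 + 3 * length (w ∷ vs))
  insertSources-∷ s vs deg w {d} refl rest = Uses-cost (cost (length vs))
    (Uses-step (Uses-step (Uses->>= (insertIfSource-uses d w s) rest)))
    where
    cost : ∀ k → 2 + (1 + (1 + 3 * k)) ≡ 1 + 3 * suc k
    cost = solve-∀

  record ArcsProcessed (s : State V) (ws ts : List V) (deg : Vec ℕ n) (D : List (V × ℕ)) (I p : List V) : Set where
    field
      {es}     : List (Event V)
      {deg′}   : Vec ℕ n
      {I′ p′}  : List V
      steps    : Steps ⟨ D , I , p ⟩ es ⟨ D , I′ , p′ ⟩
      run-uses : Uses s (processArcs ws deg s) es (deg′ , after s es) (1 + 4 * length ws)
      degrees  : Degrees deg′ ts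
      ready    : Ready I′ ts

  -- `ws` are the heads still to be processed for the deleted vertex, `ts` those belonging to later
  -- vertices. When the degree of `w` drops to zero, `w` is not in `ts`, so the last hypothesis puts
  -- all its in-neighbours among the deleted vertices.
  processArcs-spec : ∀ s ws {ts deg D I p} → Degrees deg (ws ++ ts) → Ready I (ws ++ ts) →
    (∀ {v u} → Arc v u → v ∈ keys D ⊎ u ∈ ts) → ArcsProcessed s ws ts deg D I p
  processArcs-spec s [] degrees ready _ = record
    { steps = [] ; run-uses = Uses-step Uses-return ; degrees = degrees ; ready = ready }
  processArcs-spec s (w ∷ ws) {ts} {deg} {D} {I} {p} degrees (∈⇒∉ , ∉⇒∈) arcs
    with pred (lookup deg w) in eq | Degrees-remove {deg = deg} w (ws ++ ts) degrees
  ... | zero | degrees′ = record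
    { steps    = inserts fresh (λ vw → [ id , (λ w∈ts → contradiction (∈-++⁺ʳ ws w∈ts) w∉) ]′ (arcs vw)) Rest.steps
    ; run-uses = processArcs-∷ s ws deg w eq Rest.run-uses
    ; degrees  = Rest.degrees
    ; ready    = Rest.ready
    }
    where
    count : occurrences w (ws ++ ts) ≡ pred (lookup deg w)
    count = sym (cong pred (trans (degrees w) (occurrences-here w (ws ++ ts))))
    w∉ : w ∉ ws ++ ts
    w∉ = occurrences≡0⇒∉ (ws ++ ts) (trans count eq)
    fresh : w ∉ I
    fresh w∈I = ∈⇒∉ w∈I (here refl)
    ready′ : Ready (w ∷ I) (ws ++ ts)
    ready′ = (λ { (here refl) → w∉ ; (there v∈I) → ∈⇒∉ v∈I ∘ there })
           , λ {v} v∉ → newOrOld v v∉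
      where
      newOrOld : ∀ v → v ∉ ws ++ ts → v ∈ w ∷ I
      newOrOld v v∉ with v Fin.≟ w
      ... | yes refl = here refl
      ... | no v≢w   = there (∉⇒∈ λ { (here v≡w) → v≢w v≡w ; (there v∈) → v∉ v∈ })
    module Rest = ArcsProcessed (processArcs-spec (after s (inserted w ∷ [])) ws {deg = deg [ w ]≔ 0} {D} {p = w ∷ p} degrees′ ready′ arcs)
  ... | suc d | degrees′ = record
    { steps    = Rest.steps
    ; run-uses = processArcs-∷ s ws deg w eq Rest.run-uses
    ; degrees  = Rest.degrees
    ; ready    = Rest.ready
    }
    where
    count : occurrences w (ws ++ ts) ≡ pred (lookup deg w)
    count = sym (cong pred (trans (degrees w) (occurrences-here w (ws ++ ts))))
    w∈ : w ∈ ws ++ ts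
    w∈ with w ∈? (ws ++ ts)
    ... | yes w∈′ = w∈′
    ... | no w∉   = contradiction (trans (sym eq) (trans (sym count) (∉⇒occurrences≡0 w∉))) λ ()
    ready′ : Ready I (ws ++ ts)
    ready′ = (λ v∈I → ∈⇒∉ v∈I ∘ there)
           , λ v∉ → ∉⇒∈ λ { (here refl) → v∉ w∈ ; (there v∈) → v∉ v∈ }
    module Rest = ArcsProcessed (processArcs-spec s ws {deg = deg [ w ]≔ suc d} {D} {p = p} degrees′ ready′ arcs)

  record SourcesInserted (s : State V) (vs ts : List V) (deg : Vec ℕ n) (I p : List V) : Set where
    field
      {es}       : List (Event V)
      {I′ p′}    : List V
      steps      : Steps ⟨ [] , I , p ⟩ es ⟨ [] , I′ , p′ ⟩
      run-uses   : Uses s (insertSources vs deg s) es (after s es) (1 + 3 * length vs)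
      nontargets : ∀ {w} → w ∈ I′ → w ∉ ts
      preserved  : ∀ {w} → w ∈ I → w ∈ I′
      complete   : ∀ {w} → w ∈ vs → w ∉ ts → w ∈ I′

  -- No arc has been deleted yet, so `ts` contains every head; an inserted vertex has no
  -- in-neighbours at all.
  insertSources-spec : ∀ s vs {ts deg I p} → Degrees deg ts → (∀ {v u} → Arc v u → u ∈ ts) →
    Unique vs → (∀ {w} → w ∈ vs → w ∉ I) → (∀ {w} → w ∈ I → w ∉ ts) → SourcesInserted s vs ts deg I p
  insertSources-spec s [] _ _ _ _ nontargets = record
    { steps = [] ; run-uses = Uses-step Uses-return ; nontargets = nontargets ; preserved = id ; complete = λ () }
  insertSources-spec s (w ∷ vs) {ts} {deg} {I} {p} degrees arcs (w∉vs ∷ unique) new nontargets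
    with lookup deg w in eq
  ... | zero = record
    { steps      = inserts (new (here refl)) (λ vw → contradiction (arcs vw) w∉) Rest.steps
    ; run-uses   = insertSources-∷ s vs deg w eq Rest.run-uses
    ; nontargets = Rest.nontargets
    ; preserved  = Rest.preserved ∘ there
    ; complete   = λ { (here refl) _ → Rest.preserved (here refl) ; (there v∈) → Rest.complete v∈ }
    }
    where
    w∉ : w ∉ ts
    w∉ = occurrences≡0⇒∉ ts (trans (sym (degrees w)) eq)
    new′ : ∀ {v} → v ∈ vs → v ∉ w ∷ I
    new′ v∈vs (here refl) = All.lookup w∉vs v∈vs refl
    new′ v∈vs (there v∈I) = new (there v∈vs) v∈I
    nontargets′ : ∀ {v} → v ∈ w ∷ I → v ∉ ts
    nontargets′ (here refl) = w∉
    nontargets′ (there v∈I) = nontargets v∈I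
    module Rest = SourcesInserted (insertSources-spec (after s (inserted w ∷ [])) vs {ts} {deg} {w ∷ I} {w ∷ p}
      degrees arcs unique new′ nontargets′)
  ... | suc d = record
    { steps      = Rest.steps
    ; run-uses   = insertSources-∷ s vs deg w eq Rest.run-uses
    ; nontargets = Rest.nontargets
    ; preserved  = Rest.preserved
    ; complete   = λ { (here refl) w∉ → contradiction
                         (trans (sym eq) (trans (degrees w) (∉⇒occurrences≡0 w∉))) (λ ())
                     ; (there v∈) → Rest.complete v∈ }
    }
    where
    module Rest = SourcesInserted (insertSources-spec s vs {ts} {deg} {I} {p} degrees arcs unique (new ∘ there) nontargets)

  record ArcsScanned (as : List (V × V)) (σ : List V) (deg : Vec ℕ n) (out : Vec (List V) n) : Set where
    field
      {deg′}   : Vec ℕ n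
      {out′}   : Vec (List V) n
      run≡     : run lt (scanArcs as deg out) ≡ outcome (deg′ , out′) (1 + 5 * length as) 0
      degrees  : Degrees deg′ (targets σ out′)
      size     : length (targets σ out′) ≡ length as + length (targets σ out)
      sound    : ∀ {v w} → w ∈ lookup out′ v → (v , w) ∈ as ⊎ w ∈ lookup out v
      complete : ∀ {v w} → (v , w) ∈ as ⊎ w ∈ lookup out v → w ∈ lookup out′ v

  -- `σ` enumerates all vertices. It will be the sorted enumeration, so that the main loop consumes
  -- `targets σ` from the front.
  scanArcs-spec : ∀ as {σ} deg out → Unique σ → (∀ v → v ∈ σ) → Degrees deg (targets σ out) →
    ArcsScanned as σ deg out
  scanArcs-spec [] deg out _ _ degrees = record
    { run≡ = refl ; degrees = degrees ; size = refl ; sound = inj₂ ; complete = λ { (inj₂ w∈) → w∈ } }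
  scanArcs-spec ((x , y) ∷ as) {σ} deg out unique all degrees = record
    { run≡     = trans (cong (delay 5) Rest.run≡)
                   (cong (λ t → outcome (Rest.deg′ , Rest.out′) t 0) (rearrange (length as)))
    ; degrees  = Rest.degrees
    ; size     = trans Rest.size (trans (cong (length as +_) (↭-length added)) (+-suc (length as) _))
    ; sound    = λ w∈ → [ inj₁ ∘ there , updated⁻ ]′ (Rest.sound w∈)
    ; complete = λ { (inj₁ (here refl)) → Rest.complete (inj₂ (updated⁺ (inj₁ refl)))
                   ; (inj₁ (there vw∈)) → Rest.complete (inj₁ vw∈)
                   ; (inj₂ w∈)          → Rest.complete (inj₂ (updated⁺ (inj₂ w∈))) }
    }
    where
    out₁ : Vec (List V) n
    out₁ = out [ x ]≔ (y ∷ lookup out x)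
    rearrange : ∀ k → 5 + (1 + 5 * k) ≡ 1 + 5 * suc k
    rearrange = solve-∀
    added : targets σ out₁ ↭ y ∷ targets σ out
    added = targets-add σ out y unique (all x)
    updated⁻ : ∀ {v w} → w ∈ lookup out₁ v → (v , w) ∈ (x , y) ∷ as ⊎ w ∈ lookup out v
    updated⁻ {v} {w} w∈ with v Fin.≟ x
    ... | no v≢x = inj₂ (subst (w ∈_) (lookup∘update′ v≢x out _) w∈)
    ... | yes refl with subst (w ∈_) (lookup∘update v out _) w∈
    ...   | here refl = inj₁ (here refl)
    ...   | there w∈′ = inj₂ w∈′
    updated⁺ : ∀ {v w} → (v , w) ≡ (x , y) ⊎ w ∈ lookup out v → w ∈ lookup out₁ v
    updated⁺ (inj₁ refl) = subst (y ∈_) (sym (lookup∘update x out _)) (here refl)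
    updated⁺ {v} {w} (inj₂ w∈) with v Fin.≟ x
    ... | no v≢x   = subst (w ∈_) (sym (lookup∘update′ v≢x out _)) w∈
    ... | yes refl = subst (w ∈_) (sym (lookup∘update v out _)) (there w∈)
    module Rest = ArcsScanned (scanArcs-spec as (deg [ y ]≔ suc (lookup deg y)) out₁ unique all
      (Degrees-add {deg = deg} y added degrees))

  -- The main loop and the complete run

  record Completed (s : State V) (c : Config) (loop : Comp V (List V)) (k : ℕ) : Set where
    field
      {es}     : List (Event V)
      {D}      : List (V × ℕ)
      {I L}    : List V
      steps    : Steps c es ⟨ D , I , [] ⟩
      run-uses : Uses s loop es L k
      all      : keys D ↭ allFin n

  -- Vertices are deleted in increasing order: the least remaining vertex is always a source.
  mainLoop-spec : ∀ xs {s D I p deg out} L → AllPairs _≺_ xs → keys D ++ xs ↭ allFin n →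
    Reached s ⟨ D , I , p ⟩ → Degrees deg (targets xs out) → Ready I (targets xs out) →
    (∀ {v w} → v ∈ xs → w ∈ lookup out v → Arc v w) → (∀ {v w} → v ∈ xs → Arc v w → w ∈ lookup out v) →
    Completed s ⟨ D , I , p ⟩ (mainLoop (length xs) deg out s L) (1 + 5 * length xs + 4 * length (targets xs out))
  mainLoop-spec [] {D = D} {p = p} L _ remaining reached _ _ _ _ with p | Reached-balanced reached
  ... | [] | _ = record
    { steps = [] ; run-uses = Uses-step Uses-return ; all = ↭-trans (↭-sym (↭.++-identityʳ (keys D))) remaining }
  -- Every vertex has been deleted, so anything left in the heap would be there and deleted at once.
  ... | v ∷ p | balanced = contradiction (∈-resp-↭ (↭-sym remaining) (∈-allFin v)) λ v∈ →
    Unique-++-disjoint (v ∷ p) (Unique-resp-↭ (past-↭ balanced) (past-unique balanced)) (here refl)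
      ([ id , (λ ()) ]′ (∈-++⁻ (keys D) v∈))
  mainLoop-spec (x ∷ xs) {s} {D} {I} {p} {deg} {out} L (x≺xs ∷ sorted) remaining reached degrees ready sound complete = record
    { steps    = deletes p↭ minimal (Arcs.steps ++ˢ Loop.steps)
    ; run-uses = Uses-cost cost
        (Uses-step (Uses->>= (Uses-deleteMin s (deleteMin-correct reached p↭ minimal))
          (Uses-step (Uses-step (Uses->>= Arcs.run-uses (Uses-step Loop.run-uses))))))
    ; all      = Loop.all
    }
    where
    ws = lookup out x
    ts = targets xs out
    balanced = Reached-balanced reached
    unique : Unique (keys D ++ x ∷ xs)
    unique = Unique-resp-↭ (↭-sym remaining) (allFin⁺ n)
    uniquePast : Unique (p ++ keys D)
    uniquePast = Unique-resp-↭ (past-↭ balanced) (past-unique balanced)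
    deletedOrRemaining : ∀ v → v ∈ keys D ⊎ v ∈ x ∷ xs
    deletedOrRemaining v = ∈-++⁻ (keys D) (∈-resp-↭ (↭-sym remaining) (∈-allFin v))
    x∉targets : x ∉ targets (x ∷ xs) out
    x∉targets x∈ with ∈-targets⁻ (x ∷ xs) out x∈
    ... | v , here refl , x∈out = ≺.irrefl refl (respectsArcs (sound (here refl) x∈out))
    ... | v , there v∈ , x∈out  = ≺.asym (All.lookup x≺xs v∈) (respectsArcs (sound (there v∈) x∈out))
    x∈p : x ∈ p
    x∈p = [ id , (λ x∈D → contradiction (here refl) (Unique-++-disjoint (keys D) unique x∈D)) ]′
      (∈-++⁻ p (∈-resp-↭ (past-↭ balanced) (proj₂ ready x∉targets)))
    r = proj₁ (∈⇒↭∷ x∈p)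
    p↭ : p ↭ x ∷ r
    p↭ = proj₂ (∈⇒↭∷ x∈p)
    -- What is in the heap is not deleted, hence is one of the remaining vertices, of which `x` is
    -- the least.
    minimal : All (x ≺_) r
    minimal = All.tabulate λ {v} v∈r → x≺ v v∈r (deletedOrRemaining v)
      where
      x≺ : ∀ v → v ∈ r → v ∈ keys D ⊎ v ∈ x ∷ xs → x ≺ v
      x≺ v v∈r (inj₁ v∈D)         =
        contradiction v∈D (Unique-++-disjoint p uniquePast (∈-resp-↭ (↭-sym p↭) (there v∈r)))
      x≺ v v∈r (inj₂ (here refl)) = contradiction v∈r (Unique[x∷xs]⇒x∉xs
        (Unique-resp-↭ (++⁺ʳ (keys D) p↭) uniquePast) ∘ ∈-++⁺ˡ)
      x≺ v v∈r (inj₂ (there v∈))  = All.lookup x≺xs v∈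
    D₁ = (x , workingSetSize x I) ∷ D
    s₁ = after s (deleted x ∷ [])
    deletedOrTarget : ∀ {v u} → Arc v u → v ∈ keys D₁ ⊎ u ∈ ts
    deletedOrTarget {v} vu with deletedOrRemaining v
    ... | inj₁ v∈D         = inj₁ (there v∈D)
    ... | inj₂ (here refl) = inj₁ (here refl)
    ... | inj₂ (there v∈)  = inj₂ (∈-targets⁺ xs out v∈ (complete (there v∈) vu))
    module Arcs = ArcsProcessed (processArcs-spec s₁ ws {ts} {deg} {D₁} {I} {r} degrees ready deletedOrTarget)
    out₁ = out [ x ]≔ []
    x∉xs : x ∉ xs
    x∉xs x∈xs = ≺.irrefl refl (All.lookup x≺xs x∈xs)
    ts≡ : targets xs out₁ ≡ ts
    ts≡ = targets-frame xs out x∉xs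
    out₁≡ : ∀ {v} → v ∈ xs → lookup out₁ v ≡ lookup out v
    out₁≡ v∈ = lookup∘update′ (λ { refl → x∉xs v∈ }) out []
    module Loop = Completed (mainLoop-spec xs {deg = Arcs.deg′} {out₁} (L ∷ʳ x) sorted
      (↭-trans (↭-sym (shift x (keys D) xs)) remaining)
      (Reached-after (Reached-after reached (deletes p↭ minimal [])) Arcs.steps)
      (subst (Degrees Arcs.deg′) (sym ts≡) Arcs.degrees) (subst (Ready Arcs.I′) (sym ts≡) Arcs.ready)
      (λ {v} {w} v∈ w∈ → sound (there v∈) (subst (w ∈_) (out₁≡ v∈) w∈))
      (λ {v} {w} v∈ vw → subst (w ∈_) (sym (out₁≡ v∈)) (complete (there v∈) vw)))
    cost : 1 + (0 + (2 + ((1 + 4 * length ws) + (1 + (1 + 5 * length xs + 4 * length (targets xs out₁)))))) ≡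
           1 + 5 * suc (length xs) + 4 * length (ws ++ ts)
    cost rewrite ts≡ | length-++ ws {ts} = rearrange (length ws) (length xs) (length ts)
      where
      rearrange : ∀ a b c → 1 + (0 + (2 + ((1 + 4 * a) + (1 + (1 + 5 * b + 4 * c))))) ≡ 1 + 5 * suc b + 4 * (a + c)
      rearrange = solve-∀

  -- This list exists in the proof only: it predicts the sequence of deletions and drives the
  -- induction over the main loop.
  sortedVertices : ∃[ σ ] (AllPairs _≺_ σ × σ ↭ allFin n)
  sortedVertices = σ , strictlySorted (Sorted⇒AllPairs totalOrder (sortBy-↗ decOrder (allFin n))) unique , σ↭
    where
    strictOrder : StrictTotalOrder 0ℓ 0ℓ 0ℓ
    strictOrder = record { isStrictTotalOrder = isStrictTotalOrder }
    decOrder = STO.decTotalOrder strictOrder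
    open DecTotalOrder decOrder using (totalOrder) renaming (_≤_ to _≼_)
    σ = sortBy decOrder (allFin n)
    σ↭ : σ ↭ allFin n
    σ↭ = sortBy-↭ decOrder (allFin n)
    unique : Unique σ
    unique = Unique-resp-↭ (↭-sym σ↭) (allFin⁺ n)
    strict : ∀ {x y} → x ≼ y × x ≢ y → x ≺ y
    strict (inj₁ x≺y , _)   = x≺y
    strict (inj₂ x≡y , x≢y) = contradiction x≡y x≢y
    strictlySorted : ∀ {xs} → AllPairs _≼_ xs → Unique xs → AllPairs _≺_ xs
    strictlySorted []         []         = []
    strictlySorted (ps ∷ pss) (qs ∷ qss) = All.zipWith strict (ps , qs) ∷ strictlySorted pss qss

  targets-empty : ∀ (σ : List V) → targets σ (replicate n []) ≡ []
  targets-empty []      = refl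
  targets-empty (v ∷ σ) = cong₂ _++_ (lookup-replicate v []) (targets-empty σ)

  -- With `m` arcs: 1 for the first tick, `2 n` for the arrays, `1 + 5 m` for the scan, `1 + 3 n`
  -- for the sources and `1 + 5 n + 4 m` for the main loop.
  topologicalHeapsort-spec : Completed empty initial (topologicalHeapsort arcs) (4 + 10 * n + 9 * #arcs)
  topologicalHeapsort-spec = record
    { steps    = Sources.steps ++ˢ Loop.steps
    ; run-uses = uses (trans (cong (delay 1)
        (run->>= lt (newArray n 0) _ (newArray-run lt n 0)
          (run->>= lt (newArray n []) _ (newArray-run lt n [])
            (run->>= lt (scanArcs arcs (replicate n 0) (replicate n [])) _ Scan.run≡
              (run≡ (Uses->>= Sources.run-uses loop-uses))))))
        (cong (λ t → outcome Loop.L t (heapComparisons empty (Sources.es ++ Loop.es))) cost))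
    ; all      = Loop.all
    }
    where
    σ = proj₁ sortedVertices
    sorted = proj₁ (proj₂ sortedVertices)
    σ↭ = proj₂ (proj₂ sortedVertices)
    ∈σ : ∀ v → v ∈ σ
    ∈σ v = ∈-resp-↭ (↭-sym σ↭) (∈-allFin v)
    |σ|≡n : length σ ≡ n
    |σ|≡n = trans (↭-length σ↭) (length-tabulate {n = n} id)
    module Scan = ArcsScanned (scanArcs-spec arcs {σ} (replicate n 0) (replicate n [])
      (Unique-resp-↭ (↭-sym σ↭) (allFin⁺ n)) ∈σ
      λ w → trans (lookup-replicate w 0) (sym (cong (occurrences w) (targets-empty σ))))
    ts = targets σ Scan.out′
    sound : ∀ {v w} → w ∈ lookup Scan.out′ v → Arc v w
    sound {v} {w} w∈ = [ id , (λ w∈[] → contradiction (subst (w ∈_) (lookup-replicate v []) w∈[]) λ ()) ]′ (Scan.sound w∈)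
    complete : ∀ {v w} → Arc v w → w ∈ lookup Scan.out′ v
    complete vw = Scan.complete (inj₁ vw)
    module Sources = SourcesInserted (insertSources-spec empty (allFin n) {ts} {Scan.deg′} {[]} {[]} Scan.degrees
      (λ {v} vu → ∈-targets⁺ σ Scan.out′ (∈σ v) (complete vu)) (allFin⁺ n) (λ _ ()) (λ ()))
    sourcesReached : Reached (after empty Sources.es) ⟨ [] , Sources.I′ , Sources.p′ ⟩
    sourcesReached = record { steps = Sources.steps ; state = refl }
    module Loop = Completed (mainLoop-spec σ {deg = Scan.deg′} {Scan.out′} [] sorted σ↭ sourcesReached Scan.degrees
      (Sources.nontargets , λ {w} → Sources.complete (∈-allFin w))
      (λ _ → sound) (λ _ → complete))
    loop-uses : Uses (after empty Sources.es) (mainLoop n Scan.deg′ Scan.out′ (after empty Sources.es) [])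
      Loop.es Loop.L (1 + 5 * n + 4 * #arcs)
    loop-uses = subst₂ (λ k m → Uses (after empty Sources.es) (mainLoop k Scan.deg′ Scan.out′ (after empty Sources.es) [])
        Loop.es Loop.L (1 + 5 * k + 4 * m)) |σ|≡n
      (trans Scan.size (trans (cong (λ us → #arcs + length us) (targets-empty σ)) (+-identityʳ #arcs)))
      Loop.run-uses
    cost : 1 + (n + (n + ((1 + 5 * #arcs) + ((1 + 3 * length (allFin n)) + (1 + 5 * n + 4 * #arcs)
             + heapTime empty (Sources.es ++ Loop.es))))) ≡
           4 + 10 * n + 9 * #arcs + heapTime empty (Sources.es ++ Loop.es)
    cost rewrite length-tabulate {n = n} (id {A = Fin n}) = rearrange n #arcs (heapTime empty (Sources.es ++ Loop.es))
      where
      rearrange : ∀ k m h → 1 + (k + (k + ((1 + 5 * m) + ((1 + 3 * k) + (1 + 5 * k + 4 * m) + h)))) ≡ 4 + 10 * k + 9 * m + h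
      rearrange = solve-∀

theorem4p1 : (cf ci cd : ℕ) → ∃[ C ]
    ((H : Heap) → WorkingSetBoundIfEndsEmpty H cf ci cd →
    (n : ℕ) (G : DAG n) (T : ℕ) → G hasTopologicalOrders T → 2 ≤ T →
    (O : TopologicalOrder G) →
    time (runTopologicalHeapsort H G O) ≤ C * (DAG.#arcs G + ⌊log₂ T ⌋)
    × comparisons (runTopologicalHeapsort H G O) ≤ C * (n + ⌊log₂ T ⌋))
theorem4p1 cf ci cd = 33 + 2 * ci + 9 * cd , bounds
  where
  -- Twice the factor `10 + ci + 4 * cd` of `n` in the time bound, because `n` is replaced by
  -- `2 * #arcs + 2 * t`, plus the coefficients 9 of `#arcs` and `4 + cd` of `t`.
  C = 33 + 2 * ci + 9 * cd
  bounds : (H : Heap) → WorkingSetBoundIfEndsEmpty H cf ci cd →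
    (n : ℕ) (G : DAG n) (T : ℕ) → G hasTopologicalOrders T → 2 ≤ T → (O : TopologicalOrder G) →
    time (runTopologicalHeapsort H G O) ≤ C * (DAG.#arcs G + ⌊log₂ T ⌋)
    × comparisons (runTopologicalHeapsort H G O) ≤ C * (n + ⌊log₂ T ⌋)
  bounds H workingSetBound n G T orders 2≤T O = timeBound , comparisonsBound
    where
    open DAG G using (#arcs)
    open Schedule G O
    open HeapExecution H (lessThan isStrictTotalOrder)
    open Heap H using (empty)
    open ≤-Reasoning
    instance
      T≢0 : NonZero T
      T≢0 = >-nonZero (≤-trans (s≤s z≤n) 2≤T)
    module Run = Completed (topologicalHeapsort-spec H G O)
    t = ⌊log₂ T ⌋
    1≤t : 1 ≤ t
    -- This is what absorbs the additive constants into `log T`.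
    1≤t = ⌊log₂⌋-mono-≤ 2≤T
    n≤2m+2t : n ≤ 2 * #arcs + 2 * t
    n≤2m+2t = begin
      n                   ≤⟨ vertices-bound orders O ⟩
      1 + 2 * #arcs + t   ≤⟨ +-monoˡ-≤ t (+-monoˡ-≤ (2 * #arcs) 1≤t) ⟩
      t + 2 * #arcs + t   ≡⟨ rearrange t #arcs ⟩
      2 * #arcs + 2 * t   ∎
      where
      rearrange : ∀ t m → t + 2 * m + t ≡ 2 * m + 2 * t
      rearrange = solve-∀
    heapBound : heapTime empty Run.es ≤ ci * n + cd * (n + (3 * n + t))
    heapBound = ≤-trans
      (WorkingSetBoundIfEndsEmpty.totalTime workingSetBound isStrictTotalOrder (Steps-history Run.steps))
      (timeBounds-bound cf ci cd orders Run.steps Run.all)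
    timeBound : time (runTopologicalHeapsort H G O) ≤ C * (#arcs + t)
    timeBound = begin
      time (runTopologicalHeapsort H G O)                     ≡⟨ cong time (run≡ Run.run-uses) ⟩
      4 + 10 * n + 9 * #arcs + heapTime empty Run.es          ≤⟨ +-mono-≤ (+-monoˡ-≤ (9 * #arcs) (+-monoˡ-≤ (10 * n) (*-monoʳ-≤ 4 1≤t))) heapBound ⟩
      4 * t + 10 * n + 9 * #arcs + (ci * n + cd * (n + (3 * n + t)))
        ≡⟨ collect ci cd n #arcs t ⟩
      (10 + ci + 4 * cd) * n + (9 * #arcs + (4 + cd) * t)     ≤⟨ +-monoˡ-≤ (9 * #arcs + (4 + cd) * t) (*-monoʳ-≤ (10 + ci + 4 * cd) n≤2m+2t) ⟩
      (10 + ci + 4 * cd) * (2 * #arcs + 2 * t) + (9 * #arcs + (4 + cd) * t)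
        ≤⟨ m≤m+n _ ((4 + cd) * #arcs + 9 * t) ⟩
      (10 + ci + 4 * cd) * (2 * #arcs + 2 * t) + (9 * #arcs + (4 + cd) * t) + ((4 + cd) * #arcs + 9 * t)
        ≡⟨ total ci cd #arcs t ⟩
      C * (#arcs + t)                                         ∎
      where
      collect : ∀ i d n m t → 4 * t + 10 * n + 9 * m + (i * n + d * (n + (3 * n + t))) ≡
        (10 + i + 4 * d) * n + (9 * m + (4 + d) * t)
      collect = solve-∀
      total : ∀ i d m t → (10 + i + 4 * d) * (2 * m + 2 * t) + (9 * m + (4 + d) * t) + ((4 + d) * m + 9 * t) ≡
        (33 + 2 * i + 9 * d) * (m + t)
      total = solve-∀
    comparisonsBound : comparisons (runTopologicalHeapsort H G O) ≤ C * (n + t)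
    comparisonsBound = begin
      comparisons (runTopologicalHeapsort H G O)  ≡⟨ cong comparisons (run≡ Run.run-uses) ⟩
      heapComparisons empty Run.es                ≤⟨ heapComparisons≤heapTime empty Run.es ⟩
      heapTime empty Run.es                       ≤⟨ heapBound ⟩
      ci * n + cd * (n + (3 * n + t))             ≤⟨ m≤m+n _ ((33 + ci + 5 * cd) * n + (33 + 2 * ci + 8 * cd) * t) ⟩
      ci * n + cd * (n + (3 * n + t)) + ((33 + ci + 5 * cd) * n + (33 + 2 * ci + 8 * cd) * t)
        ≡⟨ total ci cd n t ⟩
      C * (n + t)                                 ∎
      where
      total : ∀ i d n t → i * n + d * (n + (3 * n + t)) + ((33 + i + 5 * d) * n + (33 + 2 * i + 8 * d) * t) ≡
        (33 + 2 * i + 9 * d) * (n + t)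
      total = solve-∀
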